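{- Every computably approximable real in $(0,1)$ is c.a. speedable, i.e. has a computable approximation that is speedable.
   Context: Conventions: "real" means a real number in the open interval $(0,1)$. An approximation of a real $\alpha$ is a sequence $\{a_s\}_{s\in\omega}$ of rational numbers in $[0,1]$ converging to $\alpha$. It is computable if $a_s$ can be computed from $s$. A real is computably approximable (c.a.) if it has a computable approximation. A computable order is a computable function $f:\mathbb N\to\mathbb N$ that is nondecreasing and unbounded. Let $\{a_s\}_{s\in\omega}$ be a computable approximation of $\alpha$ and let $\rho\in[0,1)$ be rational. The approximation is $\rho$-speedable if either $\alpha$ is rational, or $\alpha$ is irrational and there is a computable order $f$ with $$\liminf_{s\to\infty}\left|\frac{\alpha-a_{f(s)}}{\alpha-a_s}\right|\le\rho .$$ It is speedable if it is $\rho$-speedable for some $\rho\in[0,1)$. -}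

module Defs where

open import Axiom.ExcludedMiddle using (ExcludedMiddle)
open import Data.Empty using (⊥-elim)
open import Data.Fin.Base using (Fin)
open import Data.Integer.Base using (_⊖_)
open import Data.Nat.Base as ℕ using (ℕ; suc)
import Data.Nat.Properties as ℕ
open import Data.Product.Base using (Σ-syntax; ∃-syntax; _×_; _,_)
open import Data.Rational.Base
open import Data.Rational.Properties
open import Data.Rational.Solver using (module +-*-Solver)
open import Data.Sum.Base using (_⊎_; inj₁; inj₂)
open import Data.Vec.Base using (Vec; []; _∷_; lookup)
open import Data.Vec.Relation.Binary.Pointwise.Inductive using (Pointwise)
open import Level using (0ℓ)
open import Relation.Binary.PropositionalEquality
  using (_≡_; refl; sym; trans; cong; cong₂; subst)
open import Relation.Nullary using (¬_; yes; no)

-- Computability is taken in the model of μ-recursive functions: Code n is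
-- the syntax of n-ary partial ones.

data Code : ℕ → Set where
  zeroᶜ : Code 0
  sucᶜ  : Code 1
  projᶜ : ∀ {n} → Fin n → Code n
  compᶜ : ∀ {m n} → Code m → Vec (Code n) m → Code n
  precᶜ : ∀ {n} → Code n → Code (2 ℕ.+ n) → Code (suc n)
  minᶜ  : ∀ {n} → Code (suc n) → Code n

infix 4 _[_]⇓_

-- c [ xs ]⇓ y : the partial function with code c is defined at xs, with
-- value y.  In precᶜ the recursion is on the first argument, and the step
-- function receives the counter, the previous value and the parameters.
data _[_]⇓_ : ∀ {n} → Code n → Vec ℕ n → ℕ → Set where
  zero⇓ : zeroᶜ [ [] ]⇓ 0
  suc⇓  : ∀ {x} → sucᶜ [ x ∷ [] ]⇓ suc x
  proj⇓ : ∀ {n} {i : Fin n} {xs} → projᶜ i [ xs ]⇓ lookup xs i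
  comp⇓ : ∀ {m n} {c : Code m} {cs : Vec (Code n) m} {xs ys y} →
          Pointwise (λ d z → d [ xs ]⇓ z) cs ys → c [ ys ]⇓ y →
          compᶜ c cs [ xs ]⇓ y
  prec0⇓ : ∀ {n} {c : Code n} {d xs y} →
           c [ xs ]⇓ y → precᶜ c d [ 0 ∷ xs ]⇓ y
  precS⇓ : ∀ {n} {c : Code n} {d k xs y z} →
           precᶜ c d [ k ∷ xs ]⇓ y → d [ k ∷ y ∷ xs ]⇓ z →
           precᶜ c d [ suc k ∷ xs ]⇓ z
  min⇓  : ∀ {n} {c : Code (suc n)} {xs y} →
          (∀ i → i ℕ.< y → ∃[ k ] (c [ i ∷ xs ]⇓ suc k)) →
          c [ y ∷ xs ]⇓ 0 → minᶜ c [ xs ]⇓ y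

Computable : (ℕ → ℕ) → Set
Computable f = ∃[ c ] (∀ n → c [ n ∷ [] ]⇓ f n)

ComputableSequence : (ℕ → ℚ) → Set
ComputableSequence a =
  ∃[ p ] ∃[ r ] ∃[ q ] Computable p × Computable r × Computable q ×
    (∀ s → a s ≡ (p s ⊖ r s) / suc (q s))

record ComputableOrder (f : ℕ → ℕ) : Set where
  field
    computable    : Computable f
    nondecreasing : ∀ {m n} → m ℕ.≤ n → f m ℕ.≤ f n
    unbounded     : ∀ m → ∃[ n ] m ℕ.≤ f n

IsCauchy : (ℕ → ℚ) → Set
IsCauchy x = ∀ ε → 0ℚ < ε →
  ∃[ N ] (∀ m n → N ℕ.≤ m → N ℕ.≤ n → ∣ x m - x n ∣ < ε)

-- The intended equality is _≈ᵣ_, not propositional equality.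
record ℝ : Set where
  constructor mkℝ
  field
    seq    : ℕ → ℚ
    cauchy : IsCauchy seq

open ℝ public

infix 4 _≈ᵣ_ _≤ᵣ_ _<ᵣ_

_≈ᵣ_ : ℝ → ℝ → Set
x ≈ᵣ y = ∀ ε → 0ℚ < ε → ∃[ N ] (∀ n → N ℕ.≤ n → ∣ seq x n - seq y n ∣ < ε)

_≤ᵣ_ : ℝ → ℝ → Set
x ≤ᵣ y = ∀ ε → 0ℚ < ε → ∃[ N ] (∀ n → N ℕ.≤ n → seq x n ≤ seq y n + ε)

_<ᵣ_ : ℝ → ℝ → Set
x <ᵣ y = ∃[ ε ] 0ℚ < ε × ∃[ N ] (∀ n → N ℕ.≤ n → seq x n + ε ≤ seq y n)

half-pos : ∀ {ε} → 0ℚ < ε → 0ℚ < ½ * ε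
half-pos {ε} 0<ε = positive⁻¹ (½ * ε) {{pos*pos⇒pos ½ ε {{positive 0<ε}}}}

half+half : ∀ ε → ½ * ε + ½ * ε ≡ ε
half+half ε = trans (sym (*-distribʳ-+ ε ½ ½)) (*-identityˡ ε)

flip-∣-∣ : ∀ p q → ∣ p - q ∣ ≡ ∣ q - p ∣
flip-∣-∣ p q = trans (sym (∣-p∣≡∣p∣ (p - q))) (cong ∣_∣
  (solve 2 (λ p q → :- (p :- q) := q :- p) refl p q))
  where open +-*-Solver

∣-∣-near : ∀ p q → ∣ p ∣ ≤ ∣ q ∣ + ∣ p - q ∣
∣-∣-near p q = subst (λ z → ∣ z ∣ ≤ ∣ q ∣ + ∣ p - q ∣)
  (solve 2 (λ p q → q :+ (p :- q) := p) refl p q)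
  (∣p+q∣≤∣p∣+∣q∣ q (p - q))
  where open +-*-Solver

*-mono-≤-nonNeg : ∀ {p q r s} → 0ℚ ≤ p → p ≤ q → 0ℚ ≤ r → r ≤ s → p * r ≤ q * s
*-mono-≤-nonNeg {p} {q} {r} {s} 0≤p p≤q 0≤r r≤s = ≤-trans
  (*-monoʳ-≤-nonNeg r {{nonNegative 0≤r}} p≤q)
  (*-monoˡ-≤-nonNeg q {{nonNegative (≤-trans 0≤p p≤q)}} r≤s)

shrink : ∀ B ε → 0ℚ < B → 0ℚ < ε → ∃[ δ ] 0ℚ < δ × B * δ ≡ ε
shrink B ε 0<B 0<ε = 1/B * ε ,
  positive⁻¹ (1/B * ε) {{pos*pos⇒pos 1/B {{1/pos⇒pos B {{positive 0<B}}}} ε {{positive 0<ε}}}} ,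
  trans (sym (*-assoc B 1/B ε))
    (trans (cong (_* ε) (*-inverseʳ B {{pos⇒nonZero B {{positive 0<B}}}}))
           (*-identityˡ ε))
  where
  1/B : ℚ
  1/B = (1/ B) {{pos⇒nonZero B {{positive 0<B}}}}

eventually-bounded : ∀ x → IsCauchy x →
  ∃[ B ] 0ℚ < B × ∃[ N ] (∀ n → N ℕ.≤ n → ∣ x n ∣ ≤ B)
eventually-bounded x cx with cx 1ℚ (positive⁻¹ 1ℚ)
... | N , close = ∣ x N ∣ + 1ℚ ,
  +-mono-≤-< (0≤∣p∣ (x N)) (positive⁻¹ 1ℚ) , N ,
  λ n N≤n → ≤-trans (∣-∣-near (x n) (x N))
    (+-monoʳ-≤ ∣ x N ∣ (<⇒≤ (close n N N≤n ℕ.≤-refl)))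

-- Total reciprocal with value 0 at 0.  Below it is only applied to
-- sequences that are eventually bounded away from 0.
recip : ℚ → ℚ
recip q with q ≟ 0ℚ
... | yes _   = 0ℚ
... | no q≢0 = (1/ q) {{≢-nonZero q≢0}}

recip-inverse : ∀ q → 0ℚ < ∣ q ∣ → q * recip q ≡ 1ℚ
recip-inverse q 0<∣q∣ with q ≟ 0ℚ
... | yes refl = ⊥-elim (<-irrefl refl 0<∣q∣)
... | no q≢0  = *-inverseʳ q {{≢-nonZero q≢0}}

recip-bound : ∀ q δ K → 0ℚ < δ → δ * K ≡ 1ℚ → δ ≤ ∣ q ∣ → ∣ recip q ∣ ≤ K
recip-bound q δ K 0<δ δK≡1 δ≤∣q∣ = *-cancelˡ-≤-pos δ {{positive 0<δ}}
  (≤-trans (*-monoʳ-≤-nonNeg ∣ recip q ∣ {{∣-∣-nonNeg (recip q)}} δ≤∣q∣)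
    (≤-reflexive (trans (sym (∣p*q∣≡∣p∣*∣q∣ q (recip q)))
      (trans (cong ∣_∣ (recip-inverse q (<-≤-trans 0<δ δ≤∣q∣))) (sym δK≡1)))))

ι : ℚ → ℝ
ι q = mkℝ (λ _ → q) (λ ε 0<ε → 0 , λ _ _ _ _ →
  subst (_< ε) (cong ∣_∣ (sym (+-inverseʳ q))) 0<ε)

infixl 6 _-ᵣ_

_-ᵣ_ : ℝ → ℝ → ℝ
x -ᵣ y = mkℝ (λ n → seq x n - seq y n) c
  where
  open +-*-Solver
  c : IsCauchy (λ n → seq x n - seq y n)
  c ε 0<ε with cauchy x (½ * ε) (half-pos 0<ε) | cauchy y (½ * ε) (half-pos 0<ε)
  ... | M , hx | N , hy = M ℕ.⊔ N , λ m n m≥ n≥ →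
    let xm = seq x m ; xn = seq x n ; ym = seq y m ; yn = seq y n in
    subst (λ z → ∣ z ∣ < ε)
      (solve 4 (λ a b c d → (a :- b) :- (c :- d) := (a :- c) :- (b :- d))
        refl xm xn ym yn)
      (≤-<-trans (∣p-q∣≤∣p∣+∣q∣ (xm - xn) (ym - yn))
        (subst (∣ xm - xn ∣ + ∣ ym - yn ∣ <_) (half+half ε)
          (+-mono-< (hx m n (ℕ.m⊔n≤o⇒m≤o M N m≥) (ℕ.m⊔n≤o⇒m≤o M N n≥))
                    (hy m n (ℕ.m⊔n≤o⇒n≤o M N m≥) (ℕ.m⊔n≤o⇒n≤o M N n≥)))))

∣_∣ᵣ : ℝ → ℝ
∣ x ∣ᵣ = mkℝ (λ n → ∣ seq x n ∣) c
  where
  open +-*-Solver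
  below : ∀ p q → ∣ p ∣ - ∣ q ∣ ≤ ∣ p - q ∣
  below p q = subst (∣ p ∣ - ∣ q ∣ ≤_)
    (solve 2 (λ a b → (a :+ b) :- a := b) refl ∣ q ∣ ∣ p - q ∣)
    (+-monoˡ-≤ (- ∣ q ∣) (∣-∣-near p q))
  dist : ∀ p q → ∣ ∣ p ∣ - ∣ q ∣ ∣ ≤ ∣ p - q ∣
  dist p q with ∣p∣≡p∨∣p∣≡-p (∣ p ∣ - ∣ q ∣)
  ... | inj₁ e = subst (_≤ ∣ p - q ∣) (sym e) (below p q)
  ... | inj₂ e = subst (_≤ ∣ p - q ∣) (sym e)
    (subst (_≤ ∣ p - q ∣)
      (solve 2 (λ a b → b :- a := :- (a :- b)) refl ∣ p ∣ ∣ q ∣)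
      (subst (∣ q ∣ - ∣ p ∣ ≤_) (flip-∣-∣ q p) (below q p)))
  c : IsCauchy (λ n → ∣ seq x n ∣)
  c ε 0<ε with cauchy x ε 0<ε
  ... | N , h = N , λ m n m≥ n≥ →
    ≤-<-trans (dist (seq x m) (seq x n)) (h m n m≥ n≥)

product-small : ∀ p q C θ h → 0ℚ < C → C * θ ≡ h → ∣ p ∣ ≤ C → ∣ q ∣ < θ →
                ∣ p * q ∣ < h
product-small p q C θ h 0<C Cθ≡h p≤ q< = subst (_< h) (sym (∣p*q∣≡∣p∣*∣q∣ p q))
  (≤-<-trans (*-monoʳ-≤-nonNeg ∣ q ∣ {{∣-∣-nonNeg q}} p≤)
    (subst (C * ∣ q ∣ <_) Cθ≡h (*-monoʳ-<-pos C {{positive 0<C}} q<)))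

product-difference : ∀ a b c d → a * (b - d) + d * (a - c) ≡ a * b - c * d
product-difference = solve 4
  (λ a b c d → a :* (b :- d) :+ d :* (a :- c) := a :* b :- c :* d) refl
  where open +-*-Solver

products-close : ∀ a b c d h → ∣ a * (b - d) ∣ < h → ∣ d * (a - c) ∣ < h →
                 ∣ a * b - c * d ∣ < h + h
products-close a b c d h u v = subst (λ z → ∣ z ∣ < h + h)
  (product-difference a b c d)
  (≤-<-trans (∣p+q∣≤∣p∣+∣q∣ (a * (b - d)) (d * (a - c))) (+-mono-< u v))

infixl 7 _*ᵣ_

_*ᵣ_ : ℝ → ℝ → ℝ
x *ᵣ y = mkℝ (λ n → seq x n * seq y n) c
  where
  c : IsCauchy (λ n → seq x n * seq y n)
  c ε 0<ε =
    let A , 0<A , M₁ , bx = eventually-bounded (seq x) (cauchy x)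
        B , 0<B , N₁ , by = eventually-bounded (seq y) (cauchy y)
        δ , 0<δ , Aδ = shrink A (½ * ε) 0<A (half-pos 0<ε)
        η , 0<η , Bη = shrink B (½ * ε) 0<B (half-pos 0<ε)
        M₂ , hx = cauchy x η 0<η
        N₂ , hy = cauchy y δ 0<δ
    in (M₁ ℕ.⊔ N₁) ℕ.⊔ (M₂ ℕ.⊔ N₂) , λ m n m≥ n≥ →
    let m₁ = ℕ.m⊔n≤o⇒m≤o (M₁ ℕ.⊔ N₁) (M₂ ℕ.⊔ N₂) m≥
        m₂ = ℕ.m⊔n≤o⇒n≤o (M₁ ℕ.⊔ N₁) (M₂ ℕ.⊔ N₂) m≥
        n₁ = ℕ.m⊔n≤o⇒m≤o (M₁ ℕ.⊔ N₁) (M₂ ℕ.⊔ N₂) n≥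
        n₂ = ℕ.m⊔n≤o⇒n≤o (M₁ ℕ.⊔ N₁) (M₂ ℕ.⊔ N₂) n≥
    in subst (∣ seq x m * seq y m - seq x n * seq y n ∣ <_) (half+half ε)
      (products-close (seq x m) (seq y m) (seq x n) (seq y n) (½ * ε)
        (product-small (seq x m) (seq y m - seq y n) A δ (½ * ε) 0<A Aδ
          (bx m (ℕ.m⊔n≤o⇒m≤o M₁ N₁ m₁))
          (hy m n (ℕ.m⊔n≤o⇒n≤o M₂ N₂ m₂) (ℕ.m⊔n≤o⇒n≤o M₂ N₂ n₂)))
        (product-small (seq y n) (seq x m - seq x n) B η (½ * ε) 0<B Bη
          (by n (ℕ.m⊔n≤o⇒n≤o M₁ N₁ n₁))
          (hx m n (ℕ.m⊔n≤o⇒m≤o M₂ N₂ m₂) (ℕ.m⊔n≤o⇒m≤o M₂ N₂ n₂))))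

AwayFromZero : ℝ → Set
AwayFromZero y = ∃[ δ ] 0ℚ < δ × ∃[ N ] (∀ n → N ℕ.≤ n → δ ≤ ∣ seq y n ∣)

recip-difference : ∀ p q → 0ℚ < ∣ p ∣ → 0ℚ < ∣ q ∣ →
                   (recip p * recip q) * (q - p) ≡ recip p - recip q
recip-difference p q 0<p 0<q = trans
  (solve 4 (λ a b c d → (a :* b) :* (d :- c) := a :* (d :* b) :- b :* (c :* a))
    refl (recip p) (recip q) p q)
  (trans (cong₂ (λ u v → recip p * u - recip q * v)
           (recip-inverse q 0<q) (recip-inverse p 0<p))
         (cong₂ _-_ (*-identityʳ (recip p)) (*-identityʳ (recip q))))
  where open +-*-Solver

recips-close : ∀ p q δ K η ε → 0ℚ < δ → δ * K ≡ 1ℚ → 0ℚ < K * K → K * K * η ≡ ε →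
               δ ≤ ∣ p ∣ → δ ≤ ∣ q ∣ → ∣ p - q ∣ < η → ∣ recip p - recip q ∣ < ε
recips-close p q δ K η ε 0<δ δK 0<KK KKη δ≤p δ≤q p~q =
  subst (λ z → ∣ z ∣ < ε)
    (recip-difference p q (<-≤-trans 0<δ δ≤p) (<-≤-trans 0<δ δ≤q))
    (product-small (recip p * recip q) (q - p) (K * K) η ε 0<KK KKη
      (subst (_≤ K * K) (sym (∣p*q∣≡∣p∣*∣q∣ (recip p) (recip q)))
        (*-mono-≤-nonNeg (0≤∣p∣ (recip p)) (recip-bound p δ K 0<δ δK δ≤p)
                         (0≤∣p∣ (recip q)) (recip-bound q δ K 0<δ δK δ≤q)))
      (subst (_< η) (flip-∣-∣ p q) p~q))

inv : (y : ℝ) → AwayFromZero y → ℝ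
inv y (δ , 0<δ , N₁ , away) = mkℝ (λ n → recip (seq y n)) c
  where
  c : IsCauchy (λ n → recip (seq y n))
  c ε 0<ε =
    let K , 0<K , δK = shrink δ 1ℚ 0<δ (positive⁻¹ 1ℚ)
        0<KK = positive⁻¹ (K * K)
          {{pos*pos⇒pos K {{positive 0<K}} K {{positive 0<K}}}}
        η , 0<η , KKη = shrink (K * K) ε 0<KK 0<ε
        N₂ , hy = cauchy y η 0<η
    in N₁ ℕ.⊔ N₂ , λ m n m≥ n≥ →
    recips-close (seq y m) (seq y n) δ K η ε 0<δ δK 0<KK KKη
      (away m (ℕ.m⊔n≤o⇒m≤o N₁ N₂ m≥)) (away n (ℕ.m⊔n≤o⇒m≤o N₁ N₂ n≥))
      (hy m n (ℕ.m⊔n≤o⇒n≤o N₁ N₂ m≥) (ℕ.m⊔n≤o⇒n≤o N₁ N₂ n≥))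

-- The one place where the definitions rely on classical logic.  It lets a
-- real be inverted as soon as it is not zero.
awayFromZero : ExcludedMiddle 0ℓ → (y : ℝ) → ¬ (y ≈ᵣ ι 0ℚ) → AwayFromZero y
awayFromZero em y y≉0 with em {AwayFromZero y}
... | yes away = away
... | no ¬away = ⊥-elim (y≉0 tends-to-0)
  where
  open +-*-Solver
  tends-to-0 : y ≈ᵣ ι 0ℚ
  tends-to-0 ε 0<ε with cauchy y (½ * ε) (half-pos 0<ε)
  ... | N , h = N , λ n N≤n →
    subst (λ z → ∣ z ∣ < ε) (sym (+-identityʳ (seq y n))) (small n N≤n)
    where
    small : ∀ n → N ℕ.≤ n → ∣ seq y n ∣ < ε
    small n N≤n with ∣ seq y n ∣ <? ε
    ... | yes lt = lt
    ... | no ¬lt = ⊥-elim (¬away (½ * ε , half-pos 0<ε , N , λ m N≤m →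
      let yn = seq y n ; ym = seq y m
          bound : ½ * ε + ½ * ε ≤ ∣ ym ∣ + ½ * ε
          bound = subst (_≤ ∣ ym ∣ + ½ * ε) (sym (half+half ε))
            (≤-trans (≮⇒≥ ¬lt) (≤-trans (∣-∣-near yn ym)
              (+-monoʳ-≤ ∣ ym ∣ (<⇒≤ (h n m N≤n N≤m)))))
      in subst₂≤ (cancel (½ * ε) (½ * ε)) (cancel ∣ ym ∣ (½ * ε))
           (+-monoˡ-≤ (- (½ * ε)) bound)))
      where
      cancel : ∀ p q → (p + q) - q ≡ p
      cancel = solve 2 (λ p q → (p :+ q) :- q := p) refl
      subst₂≤ : ∀ {p q r s} → p ≡ q → r ≡ s → p ≤ r → q ≤ s
      subst₂≤ refl refl p≤r = p≤r

divide : ExcludedMiddle 0ℓ → (x y : ℝ) → ¬ (y ≈ᵣ ι 0ℚ) → ℝ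
divide em x y y≉0 = x *ᵣ inv y (awayFromZero em y y≉0)

IsSupremum : (ℝ → Set) → ℝ → Set
IsSupremum P L = (∀ c → P c → c ≤ᵣ L) ×
                 (∀ u → (∀ c → P c → c ≤ᵣ u) → L ≤ᵣ u)

IsInfimum : (ℝ → Set) → ℝ → Set
IsInfimum P L = (∀ c → P c → L ≤ᵣ c) ×
                (∀ u → (∀ c → P c → u ≤ᵣ c) → u ≤ᵣ L)

-- L is the supremum over N of the infima of the tails (x s) with s ≥ N.
-- A sequence whose lower limit is infinite has no L.
IsLimInf : (ℕ → ℝ) → ℝ → Set
IsLimInf x L = IsSupremum
  (λ i → ∃[ N ] IsInfimum (λ c → ∃[ s ] N ℕ.≤ s × c ≈ᵣ x s) i) L

Rational Irrational : ℝ → Set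
Rational α   = ∃[ q ] α ≈ᵣ ι q
Irrational α = ¬ Rational α

record Approximation (α : ℝ) (a : ℕ → ℚ) : Set where
  field
    nonneg    : ∀ s → 0ℚ ≤ a s
    atMostOne : ∀ s → a s ≤ 1ℚ
    converges : ∀ ε → 0ℚ < ε →
                ∃[ N ] (∀ s → N ℕ.≤ s → ∣ ι (a s) -ᵣ α ∣ᵣ <ᵣ ι ε)

ComputableApproximation : ℝ → (ℕ → ℚ) → Set
ComputableApproximation α a = Approximation α a × ComputableSequence a

ComputablyApproximable : ℝ → Set
ComputablyApproximable α = ∃[ a ] ComputableApproximation α a

irrational-≉ : ∀ α → Irrational α → ∀ q → ¬ (α -ᵣ ι q ≈ᵣ ι 0ℚ)
irrational-≉ α irr q e = irr (q , λ ε 0<ε →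
  let N , h = e ε 0<ε in N , λ n N≤n →
    subst (λ z → ∣ z ∣ < ε) (+-identityʳ (seq α n - q)) (h n N≤n))

speedRatio : ExcludedMiddle 0ℓ → (α : ℝ) → Irrational α →
             (ℕ → ℚ) → (ℕ → ℕ) → ℕ → ℝ
speedRatio em α irr a f s =
  ∣ divide em (α -ᵣ ι (a (f s))) (α -ᵣ ι (a s)) (irrational-≉ α irr (a s)) ∣ᵣ

SpeedableWith : ExcludedMiddle 0ℓ → (α : ℝ) → (ℕ → ℚ) → ℚ → Set
SpeedableWith em α a ρ =
  Rational α ⊎
  (Σ[ irr ∈ Irrational α ] ∃[ f ] ComputableOrder f ×
    ∃[ L ] IsLimInf (speedRatio em α irr a f) L × L ≤ᵣ ι ρ)

Speedable : ExcludedMiddle 0ℓ → (α : ℝ) → (ℕ → ℚ) → Set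
Speedable em α a = ∃[ ρ ] 0ℚ ≤ ρ × ρ < 1ℚ × SpeedableWith em α a ρ

{-# OPTIONS --safe #-}

-- Let cell k s be the index g for which a_s lies in [g/(k+1), (g+1)/(k+1)].  When
-- α is irrational every cell k is eventually constant in s, so level s, the least
-- k with cell k s ≠ cell k (s+1), tends to infinity.  Infinitely many stages s
-- minimise level among all later stages, and at these the cell of a_s at
-- resolution level s ∸ 1 never changes again, hence contains α.  The new
-- approximation lists at stage s the left end, the midpoint, the right end and
-- again the midpoint of that cell: it still converges, and the midpoint is at
-- most half as far from a point of the cell as one of the two ends.
module Submission where

open import Axiom.ExcludedMiddle using (ExcludedMiddle)
open import Data.Product.Base using (_×_; ∃-syntax)
open import Data.Rational.Base using (0ℚ; 1ℚ)
open import Level using (0ℓ)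
open import Defs

-- Codes for the arithmetic of the construction.

module Computability where

  open import Data.Fin.Base using (Fin)
  open import Data.Fin.Patterns using (0F; 1F; 2F)
  open import Data.Nat.Base
  open import Data.Nat.DivMod
  open import Data.Nat.Properties
  open import Data.Product.Base using (_,_; proj₁; proj₂)
  open import Data.Sum.Base using (inj₁; inj₂)
  open import Data.Vec.Base using (Vec; []; _∷_; lookup)
  open import Data.Vec.Relation.Binary.Pointwise.Inductive using ([]; _∷_)
  open import Relation.Binary.PropositionalEquality
  open import Relation.Nullary using (yes; no; contradiction)

  Computes : ∀ {n} → Code n → (Vec ℕ n → ℕ) → Set
  Computes c F = ∀ xs → c [ xs ]⇓ F xs

  -- Working with the whole argument vector lets codes be assembled from variables, `ap₁` and `ap₂`
  -- in the shape of the function computed.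
  Recursive : ∀ n → (Vec ℕ n → ℕ) → Set
  Recursive n F = ∃[ c ] Computes {n} c F

  Computable₂ : (ℕ → ℕ → ℕ) → Set
  Computable₂ f = ∃[ c ] (∀ x y → c [ x ∷ y ∷ [] ]⇓ f x y)

  var : ∀ {n} (i : Fin n) → Recursive n (λ xs → lookup xs i)
  var i = projᶜ i , λ _ → proj⇓

  ap₁ : ∀ {n f F} → Computable f → Recursive n F → Recursive n (λ xs → f (F xs))
  ap₁ (c , h) (d , k) = compᶜ c (d ∷ []) , λ xs → comp⇓ (k xs ∷ []) (h _)

  ap₂ : ∀ {n f F G} → Computable₂ f → Recursive n F → Recursive n G →
        Recursive n (λ xs → f (F xs) (G xs))
  ap₂ (c , h) (d , k) (e , l) =
    compᶜ c (d ∷ e ∷ []) , λ xs → comp⇓ (k xs ∷ l xs ∷ []) (h _ _)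

  unary : ∀ {F} → Recursive 1 F → Computable (λ x → F (x ∷ []))
  unary (c , h) = c , λ x → h (x ∷ [])

  binary : ∀ {F} → Recursive 2 F → Computable₂ (λ x y → F (x ∷ y ∷ []))
  binary (c , h) = c , λ x y → h (x ∷ y ∷ [])

  suc-computable : Computable suc
  suc-computable = sucᶜ , λ _ → suc⇓

  const : ∀ {n} k → Recursive n (λ _ → k)
  const zero    = compᶜ zeroᶜ [] , λ _ → comp⇓ [] zero⇓
  const (suc k) = ap₁ suc-computable (const k)

  primitiveRecursion : ∀ {n} (f : ℕ → Vec ℕ n → ℕ) {step} →
    Recursive n (f 0) → Recursive (2 + n) step →
    (∀ k xs → step (k ∷ f k xs ∷ xs) ≡ f (suc k) xs) →
    ∃[ c ] (∀ k xs → c [ k ∷ xs ]⇓ f k xs)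
  primitiveRecursion f (c , base) (d , ind) step≡ = precᶜ c d , go
    where
    go : ∀ k xs → precᶜ c d [ k ∷ xs ]⇓ f k xs
    go zero    xs = prec0⇓ (base xs)
    go (suc k) xs = precS⇓ (go k xs)
      (subst (d [ k ∷ f k xs ∷ xs ]⇓_) (step≡ k xs) (ind _))

  -- The value is known beforehand to be the least root of a total test, so the unbounded search
  -- halts exactly there.
  minimisation : ∀ {n T} (F : Vec ℕ n → ℕ) → Recursive (suc n) T →
    (∀ xs → T (F xs ∷ xs) ≡ 0) → (∀ xs i → i < F xs → T (i ∷ xs) ≢ 0) →
    Recursive n F
  minimisation {T = T} F (c , h) root below = minᶜ c , λ xs → min⇓
    (λ i i<F → pred (T (i ∷ xs)) ,
      subst (c [ i ∷ xs ]⇓_) (sym (suc-pred _ {{≢-nonZero (below xs i i<F)}})) (h _))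
    (subst (c [ F xs ∷ xs ]⇓_) (root xs) (h _))

  +-computable : Computable₂ _+_
  +-computable with primitiveRecursion (λ k xs → k + lookup xs 0F)
    (var 0F) (ap₁ suc-computable (var 1F)) (λ { k (x ∷ []) → refl })
  ... | c , h = c , λ x y → h x (y ∷ [])

  *-computable : Computable₂ _*_
  *-computable with primitiveRecursion (λ k xs → k * lookup xs 0F)
    (const 0) (ap₂ +-computable (var 2F) (var 1F)) (λ { k (x ∷ []) → refl })
  ... | c , h = c , λ x y → h x (y ∷ [])

  pred-computable : Computable pred
  pred-computable with primitiveRecursion (λ k _ → pred k)
    (const 0) (var 0F) (λ k xs → refl)
  ... | c , h = c , λ x → h x []

  ∸-computable : Computable₂ _∸_
  ∸-computable with primitiveRecursion (λ k xs → lookup xs 0F ∸ k)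
    (var 0F) (ap₁ pred-computable (var 1F))
    (λ { k (x ∷ []) → pred[m∸n]≡m∸[1+n] x k })
  -- The recursion runs on the subtrahend; here the arguments are swapped back.
  ... | c , h = binary (ap₂ (c , λ k x → h k (x ∷ [])) (var 1F) (var 0F))

  ⊓-computable : Computable₂ _⊓_
  ⊓-computable with ap₂ {2} ∸-computable (var 0F) (ap₂ ∸-computable (var 0F) (var 1F))
  ... | c , h = c , λ x y → subst (c [ x ∷ y ∷ [] ]⇓_) (min≡ x y) (h _)
    where
    min≡ : ∀ x y → x ∸ (x ∸ y) ≡ x ⊓ y
    min≡ x y = trans
      (cong (_∸ (x ∸ y)) (sym (trans (cong (_+ (x ∸ y)) (⊓-comm x y)) (m⊓n+n∸m≡n y x))))
      (m+n∸n≡m (x ⊓ y) (x ∸ y))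

  ∣-∣-computable : Computable₂ ∣_-_∣
  ∣-∣-computable with ap₂ {2} +-computable
    (ap₂ ∸-computable (var 0F) (var 1F)) (ap₂ ∸-computable (var 1F) (var 0F))
  ... | c , h = c , λ x y → subst (c [ x ∷ y ∷ [] ]⇓_) (distance≡ x y) (h _)
    where
    distance≡ : ∀ x y → (x ∸ y) + (y ∸ x) ≡ ∣ x - y ∣
    distance≡ zero    zero    = refl
    distance≡ zero    (suc y) = refl
    distance≡ (suc x) zero    = +-identityʳ (suc x)
    distance≡ (suc x) (suc y) = distance≡ x y

  m<[1+m/n]*n : ∀ m k → m < suc (m / suc k) * suc k
  m<[1+m/n]*n m k = begin-strict
    m                                 ≡⟨ m≡m%n+[m/n]*n m (suc k) ⟩
    m % suc k + (m / suc k) * suc k   <⟨ +-monoˡ-< _ (m%n<n m (suc k)) ⟩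
    suc k + (m / suc k) * suc k       ∎
    where open ≤-Reasoning

  -- The quotient is the least `i` with m < (i + 1)(k + 1), tested as (m + 1) ∸ (i + 1)(k + 1) = 0.
  /suc-computable : Computable₂ (λ m k → m / suc k)
  /suc-computable = binary (minimisation (λ { (m ∷ k ∷ []) → m / suc k })
    (ap₂ ∸-computable (ap₁ suc-computable (var 1F))
      (ap₂ *-computable (ap₁ suc-computable (var 0F)) (ap₁ suc-computable (var 2F))))
    (λ { (m ∷ k ∷ []) → m≤n⇒m∸n≡0 (m<[1+m/n]*n m k) })
    (λ { (m ∷ k ∷ []) i i< →
      m>n⇒m∸n≢0 (s≤s (≤-trans (*-monoˡ-≤ (suc k) i<) (m/n*n≤m m (suc k)))) }))

  %suc-computable : Computable₂ (λ m k → m % suc k)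
  %suc-computable with ap₂ {2} ∸-computable (var 0F)
    (ap₂ *-computable (ap₂ /suc-computable (var 0F) (var 1F)) (ap₁ suc-computable (var 1F)))
  ... | c , h = c , λ m k → subst (c [ m ∷ k ∷ [] ]⇓_) (sym (m%n≡m∸m/n*n m (suc k))) (h _)

  -- The fraction A / (q + 1) ≤ 1 lies in [g/(k+1), (g+1)/(k+1)] for g = grid A q k;
  -- the cap at k keeps this cell inside [0, 1] when the fraction is 1.
  grid : ℕ → ℕ → ℕ → ℕ
  grid A q k = (A * suc k / suc q) ⊓ k

  grid-≤ : ∀ A q k → grid A q k ≤ k
  grid-≤ A q k = m⊓n≤n (A * suc k / suc q) k

  grid-lower : ∀ A q k → grid A q k * suc q ≤ A * suc k
  grid-lower A q k =
    ≤-trans (*-monoˡ-≤ (suc q) (m⊓n≤m (A * suc k / suc q) k)) (m/n*n≤m (A * suc k) (suc q))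

  grid-upper : ∀ A q k → A ≤ suc q → A * suc k ≤ suc (grid A q k) * suc q
  grid-upper A q k A≤ with ≤-total k (A * suc k / suc q)
  -- The cap is active: the right end of the cell is 1, and the fraction is at most 1 by `A≤`.
  ... | inj₁ k≤ rewrite m≥n⇒m⊓n≡n k≤ =
    ≤-trans (*-monoˡ-≤ (suc k) A≤) (≤-reflexive (*-comm (suc q) (suc k)))
  ... | inj₂ ≤k rewrite m≤n⇒m⊓n≡m ≤k = <⇒≤ (m<[1+m/n]*n (A * suc k) q)

  grid-computable : ∀ {n F G H} → Recursive n F → Recursive n G → Recursive n H →
                    Recursive n (λ xs → grid (F xs) (G xs) (H xs))
  grid-computable A q k =
    ap₂ ⊓-computable (ap₂ /suc-computable (ap₂ *-computable A (ap₁ suc-computable k)) q) k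

  leastRoot : (T : ℕ → ℕ) (m : ℕ) → T m ≡ 0 →
              ∃[ k ] T k ≡ 0 × (∀ i → i < k → T i ≢ 0)
  leastRoot T zero    Tm≡0 = 0 , Tm≡0 , λ _ ()
  leastRoot T (suc m) Tm≡0 with T 0 ≟ 0
  ... | yes T0≡0 = 0 , T0≡0 , λ _ ()
  ... | no T0≢0 with leastRoot (λ i → T (suc i)) m Tm≡0
  ...   | k , Tk≡0 , least = suc k , Tk≡0 ,
    λ { zero _ → T0≢0 ; (suc i) (s≤s i<k) → least i i<k }

  -- Levels, resolutions and the four phases of a stage.

  module Construction (A q : ℕ → ℕ) where

    cell : ℕ → ℕ → ℕ
    cell k s = grid (A s) (q s) k

    -- Zero if cell k changes at stage s, or if k ≥ s, which bounds the search.
    changeTest : ℕ → ℕ → ℕ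
    changeTest k s = (s ∸ k) * (1 ∸ ∣ cell k s - cell k (suc s) ∣)

    firstChange : ∀ s → ∃[ k ] changeTest k s ≡ 0 × (∀ i → i < k → changeTest i s ≢ 0)
    firstChange s = leastRoot (λ k → changeTest k s) s
      (cong (_* (1 ∸ ∣ cell s s - cell s (suc s) ∣)) (n∸n≡0 s))

    level : ℕ → ℕ
    level s = proj₁ (firstChange s)

    -- The finest index below `level s`, so its cell agrees at `s` and `s + 1`. When the level is 0,
    -- the value 0 is a mere default.
    resolution : ℕ → ℕ
    resolution s = pred (level s)

    unchanged : ∀ s k → k < level s → cell k s ≡ cell k (suc s)
    -- A distance of at least 1 would make the second factor of `changeTest` vanish and give a root
    -- below the least one.
    unchanged s k k<level = ∣m-n∣≡0⇒m≡n (n<1⇒n≡0 (≰⇒> λ 1≤ →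
      proj₂ (proj₂ (firstChange s)) k k<level
        (trans (cong ((s ∸ k) *_) (m≤n⇒m∸n≡0 1≤)) (*-zeroʳ (s ∸ k)))))

    level-≥ : ∀ s m → m ≤ s → (∀ k → k < m → cell k s ≡ cell k (suc s)) → m ≤ level s
    level-≥ s m m≤s same with level s <? m
    ... | no ≮ = ≮⇒≥ ≮
    -- With `level s < m ≤ s` the first factor is positive, and by `same` the second is 1, so the
    -- test cannot vanish at `level s`.
    ... | yes level<m = contradiction
      (trans (sym (*-identityʳ (s ∸ level s)))
        (trans (cong (λ z → (s ∸ level s) * (1 ∸ z))
                 (sym (m≡n⇒∣m-n∣≡0 (same (level s) level<m))))
               (proj₁ (proj₂ (firstChange s)))))
      (m>n⇒m∸n≢0 (<-≤-trans level<m m≤s))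

    -- Over the doubled denominator 2 (resolution s + 1), the values 0, 1, 2 of `j` give the left
    -- end, the midpoint and the right end of the cell.
    numerator : ℕ → ℕ → ℕ
    numerator s j = 2 * cell (resolution s) s + j

    denominator-1 : ℕ → ℕ
    denominator-1 s = 1 + 2 * resolution s

    -- 0, 1, 2, 1 at the phases 0, 1, 2, 3.
    offset : ℕ → ℕ
    offset j = j ⊓ (4 ∸ j)

    module _ (A-computable : Computable A) (q-computable : Computable q) where

      cell-computable : Computable₂ cell
      cell-computable = binary (grid-computable
        (ap₁ A-computable (var 1F)) (ap₁ q-computable (var 1F)) (var 0F))

      level-computable : Computable level
      level-computable = unary (minimisation (λ { (s ∷ []) → level s })
        (ap₂ *-computable (ap₂ ∸-computable s k)
          (ap₂ ∸-computable (const 1) (ap₂ ∣-∣-computable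
            (ap₂ cell-computable k s)
            (ap₂ cell-computable k (ap₁ suc-computable s)))))
        (λ { (s ∷ []) → proj₁ (proj₂ (firstChange s)) })
        (λ { (s ∷ []) → proj₂ (proj₂ (firstChange s)) }))
        where
        k = var 0F
        s = var 1F

      resolution-computable : Computable resolution
      resolution-computable = unary (ap₁ pred-computable (ap₁ level-computable (var 0F)))

      numerator-computable : Computable (λ t → numerator (t / 4) (offset (t % 4)))
      numerator-computable = unary (ap₂ +-computable
        (ap₂ *-computable (const 2)
          (ap₂ cell-computable (ap₁ resolution-computable s) s))
        (ap₂ ⊓-computable j (ap₂ ∸-computable (const 4) j)))
        where
        -- Stage `s` occupies the indices 4s to 4s + 3: the quotient by 4 is the stage, the
        -- remainder the phase. The constant 3 stands for its successor as divisor.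
        s = ap₂ /suc-computable (var 0F) (const 3)
        j = ap₂ %suc-computable (var 0F) (const 3)

      denominator-computable : Computable (λ t → denominator-1 (t / 4))
      denominator-computable = unary (ap₁ suc-computable (ap₂ *-computable (const 2)
        (ap₁ resolution-computable (ap₂ /suc-computable (var 0F) (const 3)))))

import Data.Integer.Base as ℤ
import Data.Integer.Properties as ℤ
import Data.Nat.Divisibility as ℕ
import Data.Nat.DivMod as ℕ
import Data.Nat.Properties as ℕ
import Data.Rational.Unnormalised.Base as ℚᵘ
import Data.Rational.Unnormalised.Properties as ℚᵘ
open import Data.Empty using (⊥)
open import Data.Fin.Patterns using (0F)
open import Data.Integer.Base using (+_; -[1+_]; _⊖_)
open import Data.Nat.Base as ℕ using (ℕ; zero; suc; z≤n; s≤s)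
open import Data.Product.Base using (_,_; proj₁; proj₂)
open import Data.Rational.Base hiding (0ℚ; 1ℚ)
open import Data.Rational.Properties
open import Data.Rational.Solver using (module +-*-Solver)
open import Data.Rational.Unnormalised.Base using (mkℚᵘ)
open import Data.Sum.Base using (_⊎_; inj₁; inj₂)
open import Relation.Binary.Definitions using (tri<; tri≈; tri>)
open import Relation.Binary.PropositionalEquality
  using (_≡_; refl; sym; trans; cong; cong₂; subst; subst₂)
open import Relation.Nullary using (Dec; ¬_; yes; no; contradiction)
open +-*-Solver using (solve; con; _:=_; _:+_; _:*_; _:-_)
open Computability

-- Rational inequalities and fractions.

lin≤ : ∀ {a b x y} → a ≤ b → y - x ≡ b - a → x ≤ y
-- Linear arithmetic by certificate: `a ≤ b` is a combination of hypotheses, and the ring solver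
-- verifies `e` at each use.
lin≤ {a} {b} {x} {y} a≤b e = subst₂ _≤_
  (solve 2 (λ x a → x :+ (a :- a) := x) refl x a)
  (trans (cong (λ z → x + z) (sym e)) (solve 2 (λ x y → x :+ (y :- x) := y) refl x y))
  (+-monoʳ-≤ x (+-monoˡ-≤ (- a) a≤b))

lin< : ∀ {a b x y} → a < b → y - x ≡ b - a → x < y
lin< {a} {b} {x} {y} a<b e = subst₂ _<_
  (solve 2 (λ x a → x :+ (a :- a) := x) refl x a)
  (trans (cong (λ z → x + z) (sym e)) (solve 2 (λ x y → x :+ (y :- x) := y) refl x y))
  (+-monoʳ-< x (+-monoˡ-< (- a) a<b))

p≤∣p∣ : ∀ p → p ≤ ∣ p ∣
p≤∣p∣ p with ≤-total 0ℚ p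
... | inj₁ 0≤p = ≤-reflexive (sym (0≤p⇒∣p∣≡p 0≤p))
... | inj₂ p≤0 = ≤-trans p≤0 (0≤∣p∣ p)

∣-∣-≥ : ∀ {p q} → q ≤ p → ∣ p - q ∣ ≡ p - q
∣-∣-≥ {p} {q} q≤p = 0≤p⇒∣p∣≡p (subst (_≤ p - q) (+-inverseʳ q) (+-monoˡ-≤ (- q) q≤p))

∣-∣-≤ : ∀ {p q} → p ≤ q → ∣ p - q ∣ ≡ q - p
∣-∣-≤ {p} {q} p≤q = trans (flip-∣-∣ p q) (∣-∣-≥ p≤q)

∣-∣-< : ∀ {p q ε} → p < q + ε → q < p + ε → ∣ p - q ∣ < ε
∣-∣-< {p} {q} {ε} p< q< with ≤-total p q
... | inj₁ p≤q = subst (_< ε) (sym (∣-∣-≤ p≤q))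
  (lin< q< (solve 3 (λ p q ε → ε :- (q :- p) := p :+ ε :- q) refl p q ε))
... | inj₂ q≤p = subst (_< ε) (sym (∣-∣-≥ q≤p))
  (lin< p< (solve 3 (λ p q ε → ε :- (p :- q) := q :+ ε :- p) refl p q ε))

∣-∣<⇒< : ∀ p q {ε} → ∣ p - q ∣ < ε → p < q + ε
∣-∣<⇒< p q {ε} h = lin< (≤-<-trans (p≤∣p∣ (p - q)) h)
  (solve 3 (λ p q ε → q :+ ε :- p := ε :- (p :- q)) refl p q ε)

∣-∣<⇒>- : ∀ p q {ε} → ∣ p - q ∣ < ε → q < p + ε
∣-∣<⇒>- p q {ε} h = ∣-∣<⇒< q p (subst (_< ε) (flip-∣-∣ p q) h)

<+⇒-≤ : ∀ p q {e} → p < q + e → p - e ≤ q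
<+⇒-≤ p q {e} h = lin≤ (<⇒≤ h) (solve 3 (λ p q e → q :- (p :- e) := q :+ e :- p) refl p q e)

chain-bound : ∀ p q r d e h → p < q + e → q - e < r + d → d ≤ h → p ≤ r + (e + e + h)
chain-bound p q r d e h p< q< d≤h = lin≤ (+-mono-≤ (<⇒≤ p<) (+-mono-≤ (<⇒≤ q<) d≤h))
  (solve 6 (λ p q r d e h → r :+ (e :+ e :+ h) :- p :=
    (q :+ e :+ (r :+ d :+ h)) :- (p :+ (q :- e :+ d))) refl p q r d e h)

-- Cross multiplication is the definition of the order on unnormalised rationals, so the comparison
-- is made there, before reduction to lowest terms.
/suc-≤ : ∀ i j k l → i ℤ.* + suc l ℤ.≤ j ℤ.* + suc k → i / suc k ≤ j / suc l
/suc-≤ i j k l h = toℚᵘ-cancel-≤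
  (ℚᵘ.≤-respˡ-≃ (ℚᵘ.≃-sym (toℚᵘ-fromℚᵘ (mkℚᵘ i k)))
    (ℚᵘ.≤-respʳ-≃ (ℚᵘ.≃-sym (toℚᵘ-fromℚᵘ (mkℚᵘ j l))) (ℚᵘ.*≤* h)))

/suc-≤⁻¹ : ∀ i j k l → i / suc k ≤ j / suc l → i ℤ.* + suc l ℤ.≤ j ℤ.* + suc k
/suc-≤⁻¹ i j k l h with
  ℚᵘ.≤-respˡ-≃ (toℚᵘ-fromℚᵘ (mkℚᵘ i k))
    (ℚᵘ.≤-respʳ-≃ (toℚᵘ-fromℚᵘ (mkℚᵘ j l)) (toℚᵘ-mono-≤ h))
... | ℚᵘ.*≤* h′ = h′

-- Opaque: unfolding the reduction to lowest terms makes conversion checks blow up.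
opaque

  frac : ℕ → ℕ → ℚ
  frac n k = + n / suc k

  frac-def : ∀ n k → frac n k ≡ + n / suc k
  frac-def n k = refl

  frac-0 : frac 0 0 ≡ 0ℚ
  frac-0 = refl

  frac-1 : frac 1 0 ≡ 1ℚ
  frac-1 = refl

  frac-≤ : ∀ m n k l → m ℕ.* suc l ℕ.≤ n ℕ.* suc k → frac m k ≤ frac n l
  frac-≤ m n k l h = /suc-≤ (+ m) (+ n) k l
    (subst₂ ℤ._≤_ (ℤ.pos-* m (suc l)) (ℤ.pos-* n (suc k)) (ℤ.+≤+ h))

  frac-≤⁻¹ : ∀ m n k l → frac m k ≤ frac n l → m ℕ.* suc l ℕ.≤ n ℕ.* suc k
  frac-≤⁻¹ m n k l h = ℤ.drop‿+≤+
    (subst₂ ℤ._≤_ (sym (ℤ.pos-* m (suc l))) (sym (ℤ.pos-* n (suc k)))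
      (/suc-≤⁻¹ (+ m) (+ n) k l h))

  frac-+ : ∀ m n k → frac m k + frac n k ≡ frac (m ℕ.+ n) k
  frac-+ m n k = toℚᵘ-injective (ℚᵘ.≃-trans (toℚᵘ-homo-+ (frac m k) (frac n k))
    (ℚᵘ.≃-trans (ℚᵘ.+-cong (toℚᵘ-fromℚᵘ (mkℚᵘ (+ m) k)) (toℚᵘ-fromℚᵘ (mkℚᵘ (+ n) k)))
      (ℚᵘ.≃-trans (ℚᵘ.*≡* (same-denominator (+ m) (+ n) (+ suc k)))
        (ℚᵘ.≃-sym (toℚᵘ-fromℚᵘ (mkℚᵘ (+ (m ℕ.+ n)) k))))))
    where
    same-denominator : ∀ i j d → (i ℤ.* d ℤ.+ j ℤ.* d) ℤ.* d ≡ (i ℤ.+ j) ℤ.* (d ℤ.* d)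
    same-denominator i j d = trans (cong (ℤ._* d) (sym (ℤ.*-distribʳ-+ d i j)))
      (ℤ.*-assoc (i ℤ.+ j) d d)

  -- The denominator is at least 1, so the absolute value of the numerator is a bound: the
  -- Archimedean property.
  ≤-frac : ∀ p → p ≤ frac ℤ.∣ ↥ p ∣ 0
  ≤-frac p@(mkℚ i d _) = subst (_≤ frac ℤ.∣ i ∣ 0) (fromℚᵘ-toℚᵘ p) (/suc-≤ i (+ ℤ.∣ i ∣) d 0
    (ℤ.≤-trans (ℤ.≤-reflexive (ℤ.*-identityʳ i)) (bound i)))
    where
    bound : ∀ i → i ℤ.≤ + ℤ.∣ i ∣ ℤ.* + suc d
    bound (+ n)      = subst (+ n ℤ.≤_) (ℤ.pos-* n (suc d)) (ℤ.+≤+ (ℕ.m≤m*n n (suc d)))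
    bound (-[1+ n ]) = subst (-[1+ n ] ℤ.≤_) (ℤ.pos-* (suc n) (suc d)) ℤ.-≤+

  frac-small : ∀ ε → 0ℚ < ε → ∃[ K ] (∀ k → K ℕ.≤ k → frac 1 k ≤ ε)
  -- For ε = (i + 1)/(d + 1) and k ≥ d: 1/(k + 1) ≤ 1/(d + 1) ≤ ε.
  frac-small p@(mkℚ (+ suc i) d _) 0<p = d , λ k d≤k →
    subst (frac 1 k ≤_) (fromℚᵘ-toℚᵘ p) (frac-≤ 1 (suc i) k d
      (ℕ.≤-trans (ℕ.≤-reflexive (ℕ.*-identityˡ (suc d)))
        (ℕ.≤-trans (s≤s d≤k) (ℕ.m≤m+n (suc k) (i ℕ.* suc k)))))
  frac-small (mkℚ (+ 0) d _) (*<* (ℤ.+<+ ()))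
  frac-small (mkℚ -[1+ i ] d _) (*<* ())

natural-above : ∀ p → ∃[ m ] p < frac m 0
natural-above p = ℤ.∣ ↥ (p + 1ℚ) ∣ ,
  <-≤-trans (subst (_< p + 1ℚ) (+-identityʳ p) (+-monoʳ-< p (positive⁻¹ 1ℚ))) (≤-frac (p + 1ℚ))

-- Eventual properties and the order on the reals.

Eventually : (ℕ → Set) → Set
Eventually P = ∃[ N ] (∀ n → N ℕ.≤ n → P n)

infixr 2 _∧ᵉ_

_∧ᵉ_ : ∀ {P Q} → Eventually P → Eventually Q → Eventually (λ n → P n × Q n)
(M , p) ∧ᵉ (N , q) = M ℕ.⊔ N , λ n le →
  p n (ℕ.m⊔n≤o⇒m≤o M N le) , q n (ℕ.m⊔n≤o⇒n≤o M N le)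

mapᵉ : ∀ {P Q : ℕ → Set} → (∀ n → P n → Q n) → Eventually P → Eventually Q
mapᵉ f (N , p) = N , λ n le → f n (p n le)

eventually-all : ∀ {P : ℕ → ℕ → Set} → (∀ i → Eventually (P i)) →
                 ∀ m → Eventually (λ n → ∀ i → i ℕ.< m → P i n)
eventually-all h zero    = 0 , λ _ _ _ ()
eventually-all {P} h (suc m) = mapᵉ
  (λ { n (now , before) i i<1+m → extend now before (ℕ.m≤n⇒m<n∨m≡n (ℕ.s≤s⁻¹ i<1+m)) })
  (h m ∧ᵉ eventually-all h m)
  where
  extend : ∀ {n i} → P m n → (∀ i → i ℕ.< m → P i n) → i ℕ.< m ⊎ i ≡ m → P i n
  extend now before (inj₁ i<m)  = before _ i<m
  extend now before (inj₂ refl) = now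

≤ᵣ-trans : ∀ x y z → x ≤ᵣ y → y ≤ᵣ z → x ≤ᵣ z
≤ᵣ-trans x y z x≤y y≤z ε 0<ε = mapᵉ
  (λ { n (p , q) → ≤-trans p (≤-trans (+-monoˡ-≤ (½ * ε) q) (≤-reflexive
    (trans (+-assoc (seq z n) (½ * ε) (½ * ε)) (cong (λ e → seq z n + e) (half+half ε))))) })
  (x≤y (½ * ε) (half-pos 0<ε) ∧ᵉ y≤z (½ * ε) (half-pos 0<ε))

≈ᵣ-refl : ∀ x → x ≈ᵣ x
≈ᵣ-refl x ε 0<ε = 0 , λ n _ →
  subst (_< ε) (cong ∣_∣ (sym (+-inverseʳ (seq x n)))) 0<ε

≈ᵣ⇒≥ᵣ : ∀ x y → x ≈ᵣ y → y ≤ᵣ x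
≈ᵣ⇒≥ᵣ x y x≈y ε 0<ε =
  mapᵉ (λ n h → <⇒≤ (∣-∣<⇒>- (seq x n) (seq y n) h)) (x≈y ε 0<ε)

≤-eventually⇒≤ᵣ : ∀ x y → Eventually (λ n → seq x n ≤ seq y n) → x ≤ᵣ y
≤-eventually⇒≤ᵣ x y h ε 0<ε = mapᵉ
  (λ n le → ≤-trans le (≤-trans (≤-reflexive (sym (+-identityʳ (seq y n))))
    (+-monoʳ-≤ (seq y n) (<⇒≤ 0<ε)))) h

-- Order completeness and lower limits.

crossing : ExcludedMiddle 0ℓ → (P : ℕ → Set) → P 0 → ∀ m → ¬ P m →
           ∃[ k ] P k × ¬ P (suc k)
crossing em P P0 zero    ¬Pm = contradiction P0 ¬Pm
crossing em P P0 (suc m) ¬Pm with em {P m}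
... | yes Pm = m , Pm , ¬Pm
... | no ¬P′ = crossing em P P0 m ¬P′

module _ (em : ExcludedMiddle 0ℓ) where

  -- For each `n`, take a lower bound k/(n + 1) such that (k + 1)/(n + 1) is none. These fractions
  -- are within 1/(n + 1) of the infimum, and their sequence represents it.
  infimum : (P : ℝ → Set) → ∃[ c ] P c → (∀ c → P c → ι 0ℚ ≤ᵣ c) →
            ∃[ L ] IsInfimum P L
  infimum P (c₀ , Pc₀) 0≤P = L , lower , greatest
    where
    LowerBound : ℚ → Set
    LowerBound p = ∀ c → P c → ι p ≤ᵣ c

    LowerBound-anti : ∀ {p q} → p ≤ q → LowerBound q → LowerBound p
    LowerBound-anti {p} {q} p≤q q-lower c Pc =
      ≤ᵣ-trans (ι p) (ι q) c (≤-eventually⇒≤ᵣ (ι p) (ι q) (0 , λ _ _ → p≤q)) (q-lower c Pc)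

    LowerBound-< : ∀ {p q} → LowerBound p → ¬ LowerBound q → p < q
    LowerBound-< p-lower ¬q-lower = ≰⇒> λ q≤p → ¬q-lower (LowerBound-anti q≤p p-lower)

    notLower : ∃[ m ] ¬ LowerBound (frac m 0)
    notLower =
      let B , _ , bounded = eventually-bounded (seq c₀) (cauchy c₀)
          -- The extra 1 absorbs the slack ε = 1 with which `m-lower` is used.
          m , B+1<m = natural-above (B + 1ℚ)
      in m , λ m-lower →
        let N , h = bounded ∧ᵉ m-lower c₀ Pc₀ 1ℚ (positive⁻¹ 1ℚ)
            ≤B , m≤ = h N ℕ.≤-refl
        in <-irrefl refl (<-≤-trans B+1<m
             (≤-trans m≤ (+-monoˡ-≤ 1ℚ (≤-trans (p≤∣p∣ (seq c₀ N)) ≤B))))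

    grid-step : ∀ n → ∃[ k ] LowerBound (frac k n) × ¬ LowerBound (frac (suc k) n)
    grid-step n = crossing em (λ k → LowerBound (frac k n))
      (LowerBound-anti (subst (frac 0 n ≤_) frac-0 (frac-≤ 0 0 n 0 z≤n)) 0≤P) (m ℕ.* suc n)
      -- The fraction m (n + 1)/(n + 1) equals `m`, which is no lower bound.
      (λ lower → proj₂ notLower (LowerBound-anti
        (frac-≤ m (m ℕ.* suc n) 0 n (ℕ.≤-reflexive (sym (ℕ.*-identityʳ _)))) lower))
      where
      m : ℕ
      m = proj₁ notLower

    approx : ℕ → ℚ
    approx n = frac (proj₁ (grid-step n)) n

    approx-lower : ∀ n → LowerBound (approx n)
    approx-lower n = proj₁ (proj₂ (grid-step n))

    -- The next grid point is no lower bound, and lower bounds are closed downwards.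
    approx-near : ∀ {p} n → LowerBound p → p < approx n + frac 1 n
    approx-near {p} n p-lower = subst (p <_)
      (trans (sym (frac-+ 1 (proj₁ (grid-step n)) n)) (+-comm (frac 1 n) (approx n)))
      (LowerBound-< p-lower (proj₂ (proj₂ (grid-step n))))

    L : ℝ
    L = mkℝ approx λ ε 0<ε →
      let K , small = frac-small ε 0<ε in K , λ m n K≤m K≤n →
      -- Each `approx m` is itself a lower bound, so `approx-near` applies in both directions.
      ∣-∣-< (<-≤-trans (approx-near n (approx-lower m)) (+-monoʳ-≤ (approx n) (small n K≤n)))
            (<-≤-trans (approx-near m (approx-lower n)) (+-monoʳ-≤ (approx m) (small m K≤m)))

    lower : ∀ c → P c → L ≤ᵣ c
    lower c Pc ε 0<ε =
      -- The threshold in `approx-lower` depends on its index, so a single `K` is fixed and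
      -- `approx n` is compared with `approx K`.
      let K , small = frac-small (½ * ε) (half-pos 0<ε) in mapᵉ
      (λ n le → ≤-trans (<⇒≤ (approx-near K (approx-lower n)))
        (≤-trans (+-mono-≤ le (small K ℕ.≤-refl)) (≤-reflexive
          (trans (+-assoc (seq c n) (½ * ε) (½ * ε)) (cong (λ e → seq c n + e) (half+half ε))))))
      (approx-lower K c Pc (½ * ε) (half-pos 0<ε))

    -- From `N` on, `u` varies by less than `e`, so `seq u N - e` is a rational lower bound and lies
    -- below `approx n + frac 1 n`. The total loss is e + e + h.
    below-approx : ∀ u → (∀ c → P c → u ≤ᵣ c) → ∀ e h → 0ℚ < e → 0ℚ < h →
                   Eventually (λ n → seq u n ≤ approx n + (e + e + h))
    below-approx u u-lower e h 0<e 0<h = mapᵉ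
      (λ { n (N≤n , small) → chain-bound (seq u n) (seq u N) (approx n) (frac 1 n) e h
        (∣-∣<⇒< (seq u n) (seq u N) (close n N N≤n ℕ.≤-refl)) (approx-near n below) small })
      ((N , λ n N≤n → N≤n) ∧ᵉ frac-small h 0<h)
      where
      N : ℕ
      N = proj₁ (cauchy u e 0<e)

      close : ∀ m n → N ℕ.≤ m → N ℕ.≤ n → ∣ seq u m - seq u n ∣ < e
      close = proj₂ (cauchy u e 0<e)

      below : LowerBound (seq u N - e)
      below c Pc = ≤ᵣ-trans (ι (seq u N - e)) u c
        (≤-eventually⇒≤ᵣ (ι (seq u N - e)) u (N , λ n N≤n →
          <+⇒-≤ (seq u N) (seq u n) (∣-∣<⇒< (seq u N) (seq u n) (close N n ℕ.≤-refl N≤n))))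
        (u-lower c Pc)

    greatest : ∀ u → (∀ c → P c → u ≤ᵣ c) → u ≤ᵣ L
    greatest u u-lower ε 0<ε = mapᵉ
      (λ n → subst (λ z → seq u n ≤ approx n + z)
        (trans (cong (_+ ½ * ε) (half+half (½ * ε))) (half+half ε)))
      -- Here ε is split as ε/4 + ε/4 + ε/2.
      (below-approx u u-lower (½ * (½ * ε)) (½ * ε) (half-pos (half-pos 0<ε)) (half-pos 0<ε))

  -- It is the infimum of the set of upper bounds, which are nonnegative because `P` has a
  -- nonnegative member.
  supremum : (P : ℝ → Set) → ∃[ c ] P c × ι 0ℚ ≤ᵣ c → ∃[ u ] (∀ c → P c → c ≤ᵣ u) →
             ∃[ L ] IsSupremum P L
  supremum P (c₀ , Pc₀ , 0≤c₀) bounded =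
    let L , lower , greatest = infimum (λ u → ∀ c → P c → c ≤ᵣ u) bounded
          (λ u u-upper → ≤ᵣ-trans (ι 0ℚ) c₀ u 0≤c₀ (u-upper c₀ Pc₀))
    in L , (λ c Pc → greatest c (λ u u-upper → u-upper c Pc)) , lower

  -- Every tail contains a term at most ρ, so ρ bounds all tail infima. This makes their supremum
  -- exist and bounds it as well.
  limInf : (x : ℕ → ℝ) (ρ : ℚ) → (∀ s → ι 0ℚ ≤ᵣ x s) →
           (∀ N → ∃[ s ] N ℕ.≤ s × x s ≤ᵣ ι ρ) →
           ∃[ L ] IsLimInf x L × L ≤ᵣ ι ρ
  limInf x ρ 0≤x often = L , L-sup , proj₂ L-sup (ι ρ) tailInf-≤ρ
    where
    Tail : ℕ → ℝ → Set
    Tail N c = ∃[ s ] N ℕ.≤ s × c ≈ᵣ x s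

    TailInf : ℝ → Set
    TailInf i = ∃[ N ] IsInfimum (Tail N) i

    0≤Tail : ∀ N c → Tail N c → ι 0ℚ ≤ᵣ c
    0≤Tail N c (s , _ , c≈xs) = ≤ᵣ-trans (ι 0ℚ) (x s) c (0≤x s) (≈ᵣ⇒≥ᵣ c (x s) c≈xs)

    tailInf-≤ρ : ∀ i → TailInf i → i ≤ᵣ ι ρ
    tailInf-≤ρ i (N , lower , _) =
      let s , N≤s , xs≤ρ = often N
      in ≤ᵣ-trans i (x s) (ι ρ) (lower (x s) (s , N≤s , ≈ᵣ-refl (x s))) xs≤ρ

    nonempty : ∃[ i ] TailInf i × ι 0ℚ ≤ᵣ i
    nonempty =
      let i , i-inf = infimum (Tail 0) (x 0 , 0 , z≤n , ≈ᵣ-refl (x 0)) (0≤Tail 0)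
      in i , (0 , i-inf) , proj₂ i-inf (ι 0ℚ) (0≤Tail 0)

    sup : ∃[ L ] IsSupremum TailInf L
    sup = supremum TailInf nonempty (ι ρ , tailInf-≤ρ)

    L : ℝ
    L = proj₁ sup

    L-sup : IsLimInf x L
    L-sup = proj₂ sup

-- Distance estimates.

gap-above : ∀ c x y {δ} → δ ≤ ∣ x - c ∣ → c ≤ x → ∣ x - y ∣ < δ → c < y
gap-above c x y {δ} gap c≤x near =
  lin< (+-mono-≤-< (subst (δ ≤_) (∣-∣-≥ c≤x) gap) (∣-∣<⇒< x y near))
    (solve 4 (λ c x y δ → y :- c := (x :- c) :+ (y :+ δ) :- (δ :+ x)) refl c x y δ)

gap-below : ∀ c x y {δ} → δ ≤ ∣ x - c ∣ → x ≤ c → ∣ x - y ∣ < δ → y < c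
gap-below c x y {δ} gap x≤c near =
  lin< (+-mono-≤-< (subst (δ ≤_) (∣-∣-≤ x≤c) gap) (∣-∣<⇒>- x y near))
    (solve 4 (λ c x y δ → c :- y := (c :- x) :+ (x :+ δ) :- (δ :+ y)) refl c x y δ)

∣-∣-between : ∀ l w {p q} → l ≤ p → p ≤ l + w → l ≤ q → q ≤ l + w → ∣ p - q ∣ ≤ w
∣-∣-between l w {p} {q} l≤p p≤ l≤q q≤ with ≤-total p q
... | inj₁ p≤q = subst (_≤ w) (sym (∣-∣-≤ p≤q)) (lin≤ (+-mono-≤ l≤p q≤)
  (solve 4 (λ l w p q → w :- (q :- p) := p :+ (l :+ w) :- (l :+ q)) refl l w p q))
... | inj₂ q≤p = subst (_≤ w) (sym (∣-∣-≥ q≤p)) (lin≤ (+-mono-≤ l≤q p≤)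
  (solve 4 (λ l w p q → w :- (p :- q) := q :+ (l :+ w) :- (l :+ p)) refl l w p q))

quotient-≤ : ∀ ρ u v → 0ℚ < ∣ v ∣ → ∣ u ∣ ≤ ρ * ∣ v ∣ → ∣ u * recip v ∣ ≤ ρ
quotient-≤ ρ u v 0<∣v∣ u≤ = subst₂ _≤_ (sym (∣p*q∣≡∣p∣*∣q∣ u (recip v)))
  (trans (*-assoc ρ ∣ v ∣ ∣ recip v ∣)
    (trans (cong (ρ *_) (trans (sym (∣p*q∣≡∣p∣*∣q∣ v (recip v)))
      (cong ∣_∣ (recip-inverse v 0<∣v∣)))) (*-identityʳ ρ)))
  (*-monoʳ-≤-nonNeg ∣ recip v ∣ {{∣-∣-nonNeg (recip v)}} u≤)

-- As 2m = l + r, the inequality x - m ≤ (x - l)/2 amounts to x ≤ r.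
midpoint-closer-left : ∀ x l m r → m + m ≡ l + r → l < x → m ≤ x → x ≤ r →
                       ∣ (x - m) * recip (x - l) ∣ ≤ ½
midpoint-closer-left x l m r mid l<x m≤x x≤r = quotient-≤ ½ (x - m) (x - l)
  (subst (0ℚ <_) (sym x-l) (subst (_< x - l) (+-inverseʳ l) (+-monoˡ-< (- l) l<x)))
  (subst₂ _≤_ (sym (∣-∣-≥ m≤x)) (cong (½ *_) (sym x-l))
    (lin≤ (*-monoˡ-≤-nonNeg ½ (+-mono-≤ x≤r (≤-reflexive (sym mid))))
      (solve 4 (λ x l m r → con ½ :* (x :- l) :- (x :- m) :=
        con ½ :* (r :+ (m :+ m)) :- con ½ :* (x :+ (l :+ r))) refl x l m r)))
  where
  x-l : ∣ x - l ∣ ≡ x - l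
  x-l = ∣-∣-≥ (<⇒≤ l<x)

-- Mirror image: m - x ≤ (r - x)/2 amounts to l ≤ x.
midpoint-closer-right : ∀ x l m r → m + m ≡ l + r → x < r → x ≤ m → l ≤ x →
                        ∣ (x - m) * recip (x - r) ∣ ≤ ½
midpoint-closer-right x l m r mid x<r x≤m l≤x = quotient-≤ ½ (x - m) (x - r)
  (subst (0ℚ <_) (sym r-x) (subst (_< r - x) (+-inverseʳ x) (+-monoˡ-< (- x) x<r)))
  (subst₂ _≤_ (sym (∣-∣-≤ x≤m)) (cong (½ *_) (sym r-x))
    (lin≤ (*-monoˡ-≤-nonNeg ½ (+-mono-≤ l≤x (≤-reflexive mid)))
      (solve 4 (λ x l m r → con ½ :* (r :- x) :- (m :- x) :=
        con ½ :* (x :+ (l :+ r)) :- con ½ :* (l :+ (m :+ m))) refl x l m r)))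
  where
  r-x : ∣ x - r ∣ ≡ r - x
  r-x = ∣-∣-≤ (<⇒≤ x<r)

+-≤⇒< : ∀ p e q → 0ℚ < e → p + e ≤ q → p < q
+-≤⇒< p e q 0<e = <-≤-trans (subst (_< p + e) (+-identityʳ p) (+-monoʳ-< p 0<e))

-- Rational cuts at an irrational limit.

Converges : ℝ → (ℕ → ℚ) → Set
Converges α a = ∀ ε → 0ℚ < ε → Eventually (λ s → ∣ ι (a s) -ᵣ α ∣ᵣ <ᵣ ι ε)

AboveBelow : ℝ → (ℕ → ℚ) → ℚ → Set
AboveBelow α a c =
  (Eventually (λ n → c < seq α n) × Eventually (λ s → c < a s)) ⊎
  (Eventually (λ n → seq α n < c) × Eventually (λ s → a s < c))

-- Irrationality keeps `seq α` eventually at distance at least some δ > 0 from `c`. Late terms of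
-- `seq α` differ by less than δ, and each late `a s` is within δ of such a term, so none of them
-- can lie across `c`.
aboveBelow : ExcludedMiddle 0ℓ → (α : ℝ) → Irrational α →
             ∀ {a} → Converges α a → ∀ c → AboveBelow α a c
aboveBelow em α irr {a} conv c = side (≤-total c (seq α N))
  where
  away : AwayFromZero (α -ᵣ ι c)
  away = awayFromZero em (α -ᵣ ι c) (irrational-≉ α irr c)

  δ : ℚ
  δ = proj₁ away

  0<δ : 0ℚ < δ
  0<δ = proj₁ (proj₂ away)

  N₁ N₂ N : ℕ
  N₁ = proj₁ (proj₂ (proj₂ away))
  N₂ = proj₁ (cauchy α δ 0<δ)
  N = N₁ ℕ.⊔ N₂

  gap : ∀ n → N ℕ.≤ n → δ ≤ ∣ seq α n - c ∣
  gap n N≤n = proj₂ (proj₂ (proj₂ away)) n (ℕ.m⊔n≤o⇒m≤o N₁ N₂ N≤n)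

  close : ∀ n → N ℕ.≤ n → ∣ seq α N - seq α n ∣ < δ
  close n N≤n = proj₂ (cauchy α δ 0<δ) N n (ℕ.m≤n⊔m N₁ N₂) (ℕ.m⊔n≤o⇒n≤o N₁ N₂ N≤n)

  meet : Eventually (λ s → ∃[ n ] N ℕ.≤ n × ∣ seq α n - a s ∣ < δ)
  meet = mapᵉ (λ s h → meets s h) (conv δ 0<δ)
    where
    meets : ∀ s → ∣ ι (a s) -ᵣ α ∣ᵣ <ᵣ ι δ → ∃[ n ] N ℕ.≤ n × ∣ seq α n - a s ∣ < δ
    meets s (e , 0<e , M , h) = n , ℕ.m≤m⊔n N M ,
      subst (_< δ) (flip-∣-∣ (a s) (seq α n))
        (+-≤⇒< ∣ a s - seq α n ∣ e δ 0<e (h n (ℕ.m≤n⊔m N M)))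
      where
      n : ℕ
      n = N ℕ.⊔ M

  side : c ≤ seq α N ⊎ seq α N ≤ c → AboveBelow α a c
  side (inj₁ c≤) = inj₁ ((N , above) , mapᵉ
    (λ { s (n , N≤n , near) → gap-above c (seq α n) (a s) (gap n N≤n) (<⇒≤ (above n N≤n)) near })
    meet)
    where
    above : ∀ n → N ℕ.≤ n → c < seq α n
    above n N≤n = gap-above c (seq α N) (seq α n) (gap N ℕ.≤-refl) c≤ (close n N≤n)
  side (inj₂ ≤c) = inj₂ ((N , below) , mapᵉ
    (λ { s (n , N≤n , near) → gap-below c (seq α n) (a s) (gap n N≤n) (<⇒≤ (below n N≤n)) near })
    meet)
    where
    below : ∀ n → N ℕ.≤ n → seq α n < c
    below n N≤n = gap-below c (seq α N) (seq α n) (gap N ℕ.≤-refl) ≤c (close n N≤n)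

-- Cells, their end points and the new approximation.

module Approximants (A q : ℕ → ℕ) (A≤q : ∀ s → A s ℕ.≤ suc (q s)) where

  open Construction A q

  source : ℕ → ℚ
  source s = frac (A s) (q s)

  -- The even points at resolution k are the multiples of 1 / (k + 1).
  point : ℕ → ℕ → ℚ
  point k i = frac i (1 ℕ.+ 2 ℕ.* k)

  value : ℕ → ℕ → ℚ
  value s j = point (resolution s) (2 ℕ.* cell (resolution s) s ℕ.+ j)

  speedable : ℕ → ℚ
  speedable t = value (t ℕ./ 4) (offset (t ℕ.% 4))

  double-scale : ∀ m k → m ℕ.* suc (1 ℕ.+ 2 ℕ.* k) ≡ 2 ℕ.* (m ℕ.* suc k)
  double-scale m k = trans (cong (m ℕ.*_) (sym (ℕ.*-suc 2 k)))
    (trans (sym (ℕ.*-assoc m 2 (suc k)))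
      (trans (cong (ℕ._* suc k) (ℕ.*-comm m 2)) (ℕ.*-assoc 2 m (suc k))))

  cell-lower : ∀ k s → point k (2 ℕ.* cell k s) ≤ source s
  cell-lower k s = frac-≤ (2 ℕ.* cell k s) (A s) (1 ℕ.+ 2 ℕ.* k) (q s)
    (ℕ.≤-trans (ℕ.≤-reflexive (ℕ.*-assoc 2 (cell k s) (suc (q s))))
      (ℕ.≤-trans (ℕ.*-monoʳ-≤ 2 (grid-lower (A s) (q s) k))
        (ℕ.≤-reflexive (sym (double-scale (A s) k)))))

  cell-upper : ∀ k s → source s ≤ point k (2 ℕ.* suc (cell k s))
  cell-upper k s = frac-≤ (A s) (2 ℕ.* suc (cell k s)) (q s) (1 ℕ.+ 2 ℕ.* k)
    (ℕ.≤-trans (ℕ.≤-reflexive (double-scale (A s) k))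
      (ℕ.≤-trans (ℕ.*-monoʳ-≤ 2 (grid-upper (A s) (q s) k (A≤q s)))
        (ℕ.≤-reflexive (sym (ℕ.*-assoc 2 (suc (cell k s)) (suc (q s)))))))

  point-mono : ∀ k {i j} → i ℕ.≤ j → point k i ≤ point k j
  point-mono k {i} {j} i≤j =
    frac-≤ i j (1 ℕ.+ 2 ℕ.* k) (1 ℕ.+ 2 ℕ.* k) (ℕ.*-monoˡ-≤ (suc (1 ℕ.+ 2 ℕ.* k)) i≤j)

  -- The right end of the lower cell does not exceed the left end of the higher one.
  cells-separated : ∀ k s s′ → cell k s ℕ.< cell k s′ →
    source s ≤ point k (2 ℕ.* cell k s′) × point k (2 ℕ.* cell k s′) ≤ source s′
  cells-separated k s s′ lt =
    ≤-trans (cell-upper k s) (point-mono k (ℕ.*-monoʳ-≤ 2 lt)) , cell-lower k s′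

  SameSide : ℚ → ℚ → ℚ → Set
  SameSide c x y = (c < x × c < y) ⊎ (x < c × y < c)

  -- If the cells differed, the left end of the higher one would lie weakly between the two terms,
  -- against the strict inequalities of `SameSide`. Indices up to `k` suffice, as `grid` is capped
  -- there.
  SameSide⇒cell≡ : ∀ k s s′ →
    (∀ i → i ℕ.< suc k → SameSide (point k (2 ℕ.* i)) (source s) (source s′)) →
    cell k s ≡ cell k s′
  SameSide⇒cell≡ k s s′ same = by (ℕ.<-cmp (cell k s) (cell k s′))
    where
    clash : ∀ {c x y} → SameSide c x y → x ≤ c → c ≤ y → ⊥
    clash (inj₁ (c<x , _)) x≤c _ = <-irrefl refl (<-≤-trans c<x x≤c)
    clash (inj₂ (_ , y<c)) _ c≤y = <-irrefl refl (<-≤-trans y<c c≤y)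

    clash′ : ∀ {c x y} → SameSide c x y → y ≤ c → c ≤ x → ⊥
    clash′ (inj₁ (_ , c<y)) y≤c _ = <-irrefl refl (<-≤-trans c<y y≤c)
    clash′ (inj₂ (x<c , _)) _ c≤x = <-irrefl refl (<-≤-trans x<c c≤x)

    bounded : ∀ s → cell k s ℕ.< suc k
    bounded s = s≤s (grid-≤ (A s) (q s) k)

    by : _ → cell k s ≡ cell k s′
    by (tri≈ _ e _) = e
    by (tri< lt _ _) = contradiction (cells-separated k s s′ lt)
      λ { (u , v) → clash (same (cell k s′) (bounded s′)) u v }
    by (tri> _ _ gt) = contradiction (cells-separated k s′ s gt)
      λ { (u , v) → clash′ (same (cell k s) (bounded s)) u v }

  numerator-≤ : ∀ s {j} → j ℕ.≤ 2 → numerator s j ℕ.≤ 2 ℕ.* suc (cell (resolution s) s)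
  numerator-≤ s j≤2 = ℕ.≤-trans (ℕ.+-monoʳ-≤ (2 ℕ.* cell (resolution s) s) j≤2)
    (ℕ.≤-reflexive (trans (ℕ.+-comm (2 ℕ.* cell (resolution s) s) 2)
      (sym (ℕ.*-suc 2 (cell (resolution s) s)))))

  value-nonneg : ∀ s j → 0ℚ ≤ value s j
  value-nonneg s j = subst (_≤ value s j) frac-0 (frac-≤ 0 (numerator s j) 0 (denominator-1 s) z≤n)

  value-≤1 : ∀ s {j} → j ℕ.≤ 2 → value s j ≤ 1ℚ
  value-≤1 s {j} j≤2 = subst (value s j ≤_) frac-1
    (frac-≤ (numerator s j) 1 (denominator-1 s) 0
      (ℕ.≤-trans (ℕ.≤-reflexive (ℕ.*-identityʳ (numerator s j)))
        (ℕ.≤-trans (numerator-≤ s j≤2)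
          (ℕ.≤-trans (ℕ.*-monoʳ-≤ 2 (s≤s (grid-≤ (A s) (q s) (resolution s))))
            (ℕ.≤-reflexive (trans (ℕ.*-suc 2 (resolution s))
              (sym (ℕ.*-identityˡ (suc (denominator-1 s))))))))))

  cell-width : ∀ k i → point k (2 ℕ.* suc i) ≤ point k (2 ℕ.* i) + frac 1 k
  cell-width k i = subst (_≤ point k (2 ℕ.* i) + frac 1 k)
    (trans (frac-+ (2 ℕ.* i) 2 (1 ℕ.+ 2 ℕ.* k))
      (cong (point k) (trans (ℕ.+-comm (2 ℕ.* i) 2) (sym (ℕ.*-suc 2 i)))))
    (+-monoʳ-≤ (point k (2 ℕ.* i)) (frac-≤ 2 1 (1 ℕ.+ 2 ℕ.* k) k
      (ℕ.≤-reflexive (trans (ℕ.*-suc 2 k) (sym (ℕ.*-identityˡ (2 ℕ.+ 2 ℕ.* k)))))))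

  -- Both points lie in one cell, whose width is 1/(k + 1).
  value-near : ∀ s {j} → j ℕ.≤ 2 → ∣ value s j - source s ∣ ≤ frac 1 (resolution s)
  value-near s {j} j≤2 = ∣-∣-between (point k (2 ℕ.* g)) (frac 1 k)
    (point-mono k (ℕ.m≤m+n (2 ℕ.* g) j))
    (≤-trans (point-mono k (numerator-≤ s j≤2)) (cell-width k g))
    (cell-lower k s)
    (≤-trans (cell-upper k s) (cell-width k g))
    where
    k g : ℕ
    k = resolution s
    g = cell k s

  value-midpoint : ∀ s → value s 1 + value s 1 ≡ value s 0 + value s 2
  value-midpoint s = trans (frac-+ (g ℕ.+ 1) (g ℕ.+ 1) D) (trans
    (cong (λ n → frac n D) (trans (ℕ.+-assoc g 1 (g ℕ.+ 1))
      (cong₂ ℕ._+_ (sym (ℕ.+-identityʳ g)) (sym (ℕ.+-suc g 1)))))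
    (sym (frac-+ (g ℕ.+ 0) (g ℕ.+ 2) D)))
    where
    g D : ℕ
    g = 2 ℕ.* cell (resolution s) s
    D = denominator-1 s

  offset-≤2 : ∀ j → offset j ℕ.≤ 2
  offset-≤2 0 = z≤n
  offset-≤2 1 = s≤s z≤n
  offset-≤2 2 = ℕ.≤-refl
  offset-≤2 (suc (suc (suc j))) = ℕ.≤-trans (ℕ.m⊓n≤n (3 ℕ.+ j) (1 ℕ.∸ j))
    (ℕ.≤-trans (ℕ.m∸n≤m 1 j) (s≤s z≤n))

  speedable-at : ∀ s j → j ℕ.≤ 3 → speedable (j ℕ.+ s ℕ.* 4) ≡ value s (offset j)
  speedable-at s j j≤3 = cong₂ (λ s j → value s (offset j))
    (trans (ℕ.+-distrib-/-∣ʳ j (ℕ.divides s refl))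
      (trans (cong (ℕ._+ s ℕ.* 4 ℕ./ 4) (ℕ.m<n⇒m/n≡0 (s≤s j≤3))) (ℕ.m*n/n≡m s 4)))
    (trans (ℕ.[m+kn]%n≡m%n j s 4) (ℕ.m≤n⇒m%n≡m j≤3))

  phase-eventually : ∀ {P : ℕ → Set} → Eventually P → Eventually (λ t → P (t ℕ./ 4))
  phase-eventually (N , h) = N ℕ.* 4 , λ t le →
    h (t ℕ./ 4) (subst (ℕ._≤ t ℕ./ 4) (ℕ.m*n/n≡m N 4) (ℕ./-monoˡ-≤ 4 le))

  cell-constant : ∀ s d → (∀ t → s ℕ.≤ t → d ℕ.< level t) →
                  ∀ t → s ℕ.≤ t → cell d s ≡ cell d t
  cell-constant s d d< t s≤t = go (ℕ.≤⇒≤′ s≤t)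
    where
    go : ∀ {t} → s ℕ.≤′ t → cell d s ≡ cell d t
    go ℕ.≤′-refl = refl
    go (ℕ.≤′-step {n} s≤n) = trans (go s≤n) (unchanged n d (d< n (ℕ.≤′⇒≤ s≤n)))

  -- While all levels stay above `resolution s`, the cell of that index is frozen and still contains
  -- each later term.
  cell-bounds : ∀ s → (∀ t → s ℕ.≤ t → resolution s ℕ.< level t) →
    ∀ t → s ℕ.≤ t → value s 0 ≤ source t × source t ≤ value s 2
  cell-bounds s d< t s≤t =
    subst (_≤ source t)
      (cong (point d) (trans (cong (2 ℕ.*_) (sym same)) (sym (ℕ.+-identityʳ _))))
      (cell-lower d t) ,
    subst (source t ≤_)
      (cong (point d) (trans (cong (λ g → 2 ℕ.* suc g) (sym same))
        (trans (ℕ.*-suc 2 (cell d s)) (ℕ.+-comm 2 _))))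
      (cell-upper d t)
    where
    d : ℕ
    d = resolution s
    same : cell d s ≡ cell d t
    same = cell-constant s d d< t s≤t

-- True stages and the speed-up.

trueStage : ExcludedMiddle 0ℓ → (v : ℕ → ℕ) (N : ℕ) →
            ∃[ s ] N ℕ.≤ s × (∀ t → s ℕ.≤ t → v s ℕ.≤ v t)
trueStage em v N = search (v N) N ℕ.≤-refl
  where
  -- Descent: as long as a later value is smaller, move to it. The bound `m` on the current value
  -- drops at each move.
  search : ∀ m N → v N ℕ.≤ m → ∃[ s ] N ℕ.≤ s × (∀ t → s ℕ.≤ t → v s ℕ.≤ v t)
  search m N vN≤m with em {∃[ t ] N ℕ.≤ t × v t ℕ.< v N}
  search m N vN≤m | no none =
    N , ℕ.≤-refl , λ t N≤t → ℕ.≮⇒≥ λ lt → none (t , N≤t , lt)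
  search zero N vN≤m | yes (t , N≤t , lt) = contradiction (ℕ.≤-trans lt vN≤m) λ ()
  search (suc m) N vN≤m | yes (t , N≤t , lt) =
    let s , t≤s , true = search m t (ℕ.s≤s⁻¹ (ℕ.≤-trans lt vN≤m))
    in s , ℕ.≤-trans N≤t t≤s , true

module Speedup (em : ExcludedMiddle 0ℓ) (α : ℝ) (irr : Irrational α)
  (A q : ℕ → ℕ) (A≤q : ∀ s → A s ℕ.≤ suc (q s))
  (conv : Converges α (λ s → frac (A s) (q s))) where

  open Construction A q
  open Approximants A q A≤q

  side : ∀ c → AboveBelow α source c
  side = aboveBelow em α irr conv

  -- Each of the finitely many grid points i/(k + 1) with i ≤ k differs from the irrational α, so
  -- the terms eventually stop crossing it.
  cell-stable : ∀ k → Eventually (λ s → cell k s ≡ cell k (suc s))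
  cell-stable k = mapᵉ (λ s same → SameSide⇒cell≡ k s (suc s) same)
    (eventually-all (λ i → sameSide (point k (2 ℕ.* i)) (side _)) (suc k))
    where
    sameSide : ∀ c → AboveBelow α source c →
               Eventually (λ s → SameSide c (source s) (source (suc s)))
    sameSide c (inj₁ (_ , N , h)) = N , λ n N≤n → inj₁ (h n N≤n , h (suc n) (ℕ.m≤n⇒m≤1+n N≤n))
    sameSide c (inj₂ (_ , N , h)) = N , λ n N≤n → inj₂ (h n N≤n , h (suc n) (ℕ.m≤n⇒m≤1+n N≤n))

  -- The cells of index below `m` all settle. The condition s ≥ m enters because `level s` never
  -- exceeds `s`.
  level-unbounded : ∀ m → Eventually (λ s → m ℕ.≤ level s)
  level-unbounded m = mapᵉ (λ { s (m≤s , same) → level-≥ s m m≤s same })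
    ((m , λ s m≤s → m≤s) ∧ᵉ eventually-all cell-stable m)

  resolution-unbounded : ∀ m → Eventually (λ s → m ℕ.≤ resolution s)
  resolution-unbounded m = mapᵉ (λ s le → ℕ.pred-mono-≤ le) (level-unbounded (suc m))

  close-transfer : ∀ (b : ℚ) s ε h → h + h ≡ ε → ∣ b - source s ∣ ≤ h →
    ∣ ι (source s) -ᵣ α ∣ᵣ <ᵣ ι h → ∣ ι b -ᵣ α ∣ᵣ <ᵣ ι ε
  close-transfer b s ε h h+h≡ε near (e , 0<e , N , close) = e , 0<e , N , λ n N≤n →
    subst (∣ b - seq α n ∣ + e ≤_) h+h≡ε
      (triangle b (source s) (seq α n) near (close n N≤n))
    where
    triangle : ∀ x y z → ∣ x - y ∣ ≤ h → ∣ y - z ∣ + e ≤ h → ∣ x - z ∣ + e ≤ h + h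
    triangle x y z xy yz = ≤-trans
      (+-monoˡ-≤ e (subst (λ w → ∣ w ∣ ≤ ∣ x - y ∣ + ∣ y - z ∣)
        (solve 3 (λ x y z → (x :- y) :+ (y :- z) := x :- z) refl x y z)
        (∣p+q∣≤∣p∣+∣q∣ (x - y) (y - z))))
      (subst (_≤ h + h) (sym (+-assoc ∣ x - y ∣ ∣ y - z ∣ e)) (+-mono-≤ xy yz))

  -- Each new term is within one cell width of the old term of its stage, and these widths tend to 0
  -- because the resolution tends to infinity.
  speedable-approximation : Approximation α speedable
  speedable-approximation = record
    { nonneg    = λ t → value-nonneg (t ℕ./ 4) (offset (t ℕ.% 4))
    ; atMostOne = λ t → value-≤1 (t ℕ./ 4) (offset-≤2 (t ℕ.% 4))
    ; converges = λ ε 0<ε → converges ε (½ * ε) (half-pos 0<ε) (half+half ε)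
    }
    where
    converges : ∀ ε h → 0ℚ < h → h + h ≡ ε →
                Eventually (λ t → ∣ ι (speedable t) -ᵣ α ∣ᵣ <ᵣ ι ε)
    converges ε h 0<h h+h≡ε =
      let K , small = frac-small h 0<h in mapᵉ
      (λ { t (K≤ , close) → close-transfer (speedable t) (t ℕ./ 4) ε h h+h≡ε
        (≤-trans (value-near (t ℕ./ 4) (offset-≤2 (t ℕ.% 4))) (small _ K≤)) close })
      (phase-eventually (resolution-unbounded K ∧ᵉ conv h 0<h))

  -- By irrationality α is strictly on one side of `c`, and the terms eventually share that side; a
  -- weak bound on the terms excludes the wrong one.
  always-above : ∀ c → Eventually (λ s → c ≤ source s) → Eventually (λ n → c < seq α n)
  always-above c = by (side c)
    where
    by : AboveBelow α source c → _ → Eventually (λ n → c < seq α n)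
    by (inj₁ (above , _)) _ = above
    by (inj₂ (_ , below)) ev =
      let N , h = ev ∧ᵉ below ; c≤ , <c = h N ℕ.≤-refl
      in contradiction (<-≤-trans <c c≤) (<-irrefl refl)

  always-below : ∀ c → Eventually (λ s → source s ≤ c) → Eventually (λ n → seq α n < c)
  always-below c = by (side c)
    where
    by : AboveBelow α source c → _ → Eventually (λ n → seq α n < c)
    by (inj₂ (below , _)) _ = below
    by (inj₁ (_ , above)) ev =
      let N , h = ev ∧ᵉ above ; ≤c , c< = h N ℕ.≤-refl
      in contradiction (<-≤-trans c< ≤c) (<-irrefl refl)

  -- The successor serves as the order: in the new list each end of a cell is followed directly by
  -- the midpoint.
  ratio : ℕ → ℝ
  ratio = speedRatio em α irr speedable suc

  Halves : ℕ → ℚ → ℚ → Set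
  Halves n b b′ = ∣ (seq α n - b′) * recip (seq α n - b) ∣ ≤ ½

  -- With `j ≤ 2` the next index still belongs to the four phases of stage `s`.
  ratio-≤½ : ∀ s j → j ℕ.≤ 2 →
    Eventually (λ n → Halves n (value s (offset j)) (value s (offset (suc j)))) →
    ratio (j ℕ.+ s ℕ.* 4) ≤ᵣ ι ½
  ratio-≤½ s j j≤2 ev = ≤-eventually⇒≤ᵣ (ratio (j ℕ.+ s ℕ.* 4)) (ι ½)
    (mapᵉ (λ n → subst₂ (Halves n) (sym (speedable-at s j (ℕ.m≤n⇒m≤1+n j≤2)))
                                   (sym (speedable-at s (suc j) (s≤s j≤2)))) ev)

  -- At a stage whose level is minimal from there on, the cell contains α; the half containing α
  -- decides between phases 0 and 2.
  often-≤½ : ∀ N → ∃[ t ] N ℕ.≤ t × ratio t ≤ᵣ ι ½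
  often-≤½ N = by (side (value s 1))
    where
    M s : ℕ
    M = proj₁ (level-unbounded 1)
    stage : ∃[ s ] N ℕ.⊔ M ℕ.≤ s × (∀ t → s ℕ.≤ t → level s ℕ.≤ level t)
    stage = trueStage em level (N ℕ.⊔ M)
    s = proj₁ stage

    N≤s+ : ∀ j → N ℕ.≤ j ℕ.+ s ℕ.* 4
    N≤s+ j = ℕ.≤-trans (ℕ.m⊔n≤o⇒m≤o N M (proj₁ (proj₂ stage)))
      (ℕ.≤-trans (ℕ.m≤m*n s 4) (ℕ.m≤n+m (s ℕ.* 4) j))

    1≤level : 1 ℕ.≤ level s
    1≤level = proj₂ (level-unbounded 1) s (ℕ.m⊔n≤o⇒n≤o N M (proj₁ (proj₂ stage)))

    resolution< : ∀ t → s ℕ.≤ t → resolution s ℕ.< level t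
    -- Since `level s ≥ 1`, `resolution s` is a genuine predecessor; for this `s` was taken beyond
    -- `M`.
    resolution< t s≤t = ℕ.≤-trans
      (ℕ.≤-reflexive (ℕ.suc-pred (level s) {{ℕ.>-nonZero 1≤level}}))
      (proj₂ (proj₂ stage) t s≤t)

    above : Eventually (λ n → value s 0 < seq α n)
    above = always-above (value s 0) (s , λ t s≤t → proj₁ (cell-bounds s resolution< t s≤t))

    below : Eventually (λ n → seq α n < value s 2)
    below = always-below (value s 2) (s , λ t s≤t → proj₂ (cell-bounds s resolution< t s≤t))

    by : AboveBelow α source (value s 1) → ∃[ t ] N ℕ.≤ t × ratio t ≤ᵣ ι ½
    -- In the right half, the step goes from the left end to the midpoint.
    by (inj₁ (m< , _)) = 0 ℕ.+ s ℕ.* 4 , N≤s+ 0 , ratio-≤½ s 0 z≤n (mapᵉ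
      (λ { n (l< , m< , <r) → midpoint-closer-left (seq α n) (value s 0) (value s 1) (value s 2)
        (value-midpoint s) l< (<⇒≤ m<) (<⇒≤ <r) })
      (above ∧ᵉ m< ∧ᵉ below))
    -- In the left half, the step goes from the right end to the midpoint.
    by (inj₂ (<m , _)) = 2 ℕ.+ s ℕ.* 4 , N≤s+ 2 , ratio-≤½ s 2 ℕ.≤-refl (mapᵉ
      (λ { n (l< , <m , <r) → midpoint-closer-right (seq α n) (value s 0) (value s 1) (value s 2)
        (value-midpoint s) <r (<⇒≤ <m) (<⇒≤ l<) })
      (above ∧ᵉ <m ∧ᵉ below))

  suc-order : ComputableOrder suc
  suc-order = record
    { computable = suc-computable ; nondecreasing = s≤s ; unbounded = λ m → m , ℕ.n≤1+n m }

  speedable-isSpeedable : Speedable em α speedable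
  speedable-isSpeedable = ½ , <⇒≤ (positive⁻¹ ½) , *<* (ℤ.+<+ ℕ.≤-refl) ,
    inj₂ (irr , suc , suc-order , limInf em ratio ½
      (λ t → ≤-eventually⇒≤ᵣ (ι 0ℚ) (ratio t) (0 , λ n _ → 0≤∣p∣ _)) often-≤½)

  speedable-computable : Computable A → Computable q → ComputableSequence speedable
  -- The new terms are nonnegative, so the subtracted part is 0.
  speedable-computable cA cq = _ , (λ _ → 0) , _ ,
    numerator-computable cA cq , unary (const {1} 0) , denominator-computable cA cq ,
    λ t → frac-def (numerator (t ℕ./ 4) (offset (t ℕ.% 4))) (denominator-1 (t ℕ./ 4))

-- Reduction to fractions of natural numbers.

⊖-nonneg : ∀ p r k → 0ℚ ≤ (p ⊖ r) / suc k → r ℕ.≤ p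
⊖-nonneg p r k h = ℤ.drop‿+≤+ (ℤ.0≤i-j⇒j≤i {+ p} {+ r}
  (subst (ℤ.0ℤ ℤ.≤_) (trans (ℤ.*-identityʳ (p ⊖ r)) (sym (ℤ.m-n≡m⊖n p r)))
    (/suc-≤⁻¹ ℤ.0ℤ (p ⊖ r) 0 k h)))

-- Nonnegativity forces r ≤ p, so truncated subtraction loses nothing.
nonneg-frac : ∀ p r k → 0ℚ ≤ (p ⊖ r) / suc k → (p ⊖ r) / suc k ≡ frac (p ℕ.∸ r) k
nonneg-frac p r k h = trans (cong (_/ suc k) (ℤ.⊖-≥ (⊖-nonneg p r k h)))
  (sym (frac-def (p ℕ.∸ r) k))

frac-≤1 : ∀ m k → frac m k ≤ 1ℚ → m ℕ.≤ suc k
frac-≤1 m k h = subst₂ ℕ._≤_ (ℕ.*-identityʳ m) (ℕ.*-identityˡ (suc k))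
  (frac-≤⁻¹ m 1 k 0 (subst (frac m k ≤_) (sym frac-1) h))

corollary3p3 : (em : ExcludedMiddle 0ℓ) (α : ℝ) →
    ι 0ℚ <ᵣ α → α <ᵣ ι 1ℚ → ComputablyApproximable α →
    ∃[ b ] ComputableApproximation α b × Speedable em α b
corollary3p3 em α _ _ (a , a-approx , a-computable@(p , r , q , cp , cr , cq , a≡)) =
  by em
  where
  module a = Approximation a-approx

  A : ℕ → ℕ
  A s = p s ℕ.∸ r s

  a≡frac : ∀ s → a s ≡ frac (A s) (q s)
  a≡frac s = trans (a≡ s) (nonneg-frac (p s) (r s) (q s) (subst (0ℚ ≤_) (a≡ s) (a.nonneg s)))

  cA : Computable A
  cA = unary (ap₂ ∸-computable (ap₁ cp (var 0F)) (ap₁ cr (var 0F)))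

  by : Dec (Rational α) → ∃[ b ] ComputableApproximation α b × Speedable em α b
  -- For rational α the given approximation is speedable by definition, with ρ = 0.
  by (yes rational) = a , (a-approx , a-computable) ,
    0ℚ , ≤-refl , positive⁻¹ 1ℚ , inj₁ rational
  by (no irr) = speedable , (speedable-approximation , speedable-computable cA cq) ,
    speedable-isSpeedable
    where
    A≤q : ∀ s → A s ℕ.≤ suc (q s)
    A≤q s = frac-≤1 (A s) (q s) (subst (_≤ 1ℚ) (a≡frac s) (a.atMostOne s))
    conv : Converges α (λ s → frac (A s) (q s))
    conv ε 0<ε = mapᵉ (λ s → subst (λ x → ∣ ι x -ᵣ α ∣ᵣ <ᵣ ι ε) (a≡frac s)) (a.converges ε 0<ε)
    open Approximants A q A≤q
    open Speedup em α irr A q A≤q conv
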